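{- For every integer $n\ge 1$, \[\overline{p}(3n)\equiv (-1)^n\, r_5(n) \pmod 9.\]
   Context: An overpartition of a nonnegative integer $n$ is a partition of $n$ in which the first occurrence of each distinct part may (or may not) be overlined; $\overline{p}(n)$ denotes the number of overpartitions of $n$ (with $\overline{p}(0)=1$). Equivalently, $\sum_{n\ge0}\overline{p}(n)q^n=\prod_{k\ge1}\frac{1+q^k}{1-q^k}=1/\varphi(-q)$, where $\varphi(q)=\sum_{n=-\infty}^{\infty}q^{n^2}$. For an integer $k\ge1$, $r_k(n)$ denotes the number of $(x_1,\dots,x_k)\in\mathbb{Z}^k$ with $x_1^2+\cdots+x_k^2=n$. -}

module Defs where

open import Data.Bool using (Bool; true; false)
import Data.Bool.Properties as Bool
open import Data.Integer using (ℤ; +_; -[1+_]; 0ℤ; ∣_∣)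
import Data.Integer as ℤ
import Data.Integer.Divisibility as ℤ
import Data.Integer.Properties as ℤ
open import Data.List using (List; []; _∷_; _++_; length; map; filter; upTo; cartesianProduct; cartesianProductWith)
open import Data.List.Membership.Propositional using (_∈_)
open import Data.List.Membership.Propositional.Properties
import Data.List.Properties as List
open import Data.List.Relation.Unary.All as All using (All; []; _∷_)
import Data.List.Relation.Unary.AllPairs as AllPairs
open import Data.List.Relation.Unary.Any using (here; there)
open import Data.List.Relation.Unary.Linked using (Linked; linked?)
open import Data.List.Relation.Unary.Unique.Propositional using (Unique)
import Data.List.Relation.Unary.Unique.Propositional.Properties as Unique
open import Data.Empty using (⊥)
open import Data.Nat using (ℕ; zero; suc; _+_; _*_; _≤_; _<_; z≤n; s≤s; _<?_; _≟_)
open import Data.Nat.ListAction using (sum)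
open import Data.Nat.Properties using (≤-trans; ≤-reflexive; m≤m+n; m≤n+m; m≤m*n; +-mono-≤)
open import Data.Product using (_×_; _,_; proj₁; proj₂)
open import Data.Sum using (_⊎_)
open import Data.Vec as Vec using (Vec; []; _∷_)
import Data.Vec.Properties as Vec
import Data.Vec.Relation.Unary.All as VecAll
open import Function using (_⇔_; mk⇔)
open import Relation.Binary.PropositionalEquality using (_≡_; _≢_; refl; sym; trans; cong₂)
open import Relation.Nullary using (Dec)
open import Relation.Nullary.Decidable using (_×-dec_; _⊎-dec_)
open import Relation.Unary using (Decidable)

------------------------------------------------------------------------
-- Counting

-- `size` is the number of x satisfying P; it does not depend on which
-- enumeration of P is chosen.
record Enumeration {A : Set} (P : A → Set) : Set where
  field
    elements : List A
    unique   : Unique elements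
    ∈⇔       : ∀ x → x ∈ elements ⇔ P x

  size : ℕ
  size = length elements

filterEnumeration : ∀ {A : Set} {P : A → Set} → Decidable P →
  (xs : List A) → Unique xs → (∀ x → P x → x ∈ xs) → Enumeration P
filterEnumeration P? xs xs! complete = record
  { elements = filter P? xs
  ; unique   = Unique.filter⁺ P? xs!
  ; ∈⇔       = λ x → mk⇔ (λ x∈ → proj₂ (∈-filter⁻ P? {xs = xs} x∈))
                          (λ px → ∈-filter⁺ P? (complete x px) px)
  }

------------------------------------------------------------------------
-- Congruence of integers

infix 4 _≡_[mod_]

_≡_[mod_] : ℤ → ℤ → ℤ → Set
a ≡ b [mod m ] = m ℤ.∣ (a ℤ.- b)

------------------------------------------------------------------------
-- Overpartitions

-- The size of the part, and whether it is overlined.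
Part : Set
Part = ℕ × Bool

-- `x CanPrecede y`: parts are listed in weakly decreasing order of size, and
-- a part equal in size to its predecessor is not a first occurrence, so it
-- is not overlined.
_CanPrecede_ : Part → Part → Set
(a , _) CanPrecede (b , overlined) = b < a ⊎ (b ≡ a × overlined ≡ false)

IsOverpartition : ℕ → List Part → Set
IsOverpartition n ps =
  All (λ p → 0 < proj₁ p) ps × Linked _CanPrecede_ ps × sum (map proj₁ ps) ≡ n

isOverpartition? : ∀ n → Decidable (IsOverpartition n)
isOverpartition? n ps =
  All.all? (λ p → 0 <? proj₁ p) ps
    ×-dec linked? canPrecede? ps
    ×-dec sum (map proj₁ ps) ≟ n
  where
  canPrecede? : ∀ x y → Dec (x CanPrecede y)
  canPrecede? (a , _) (b , o) = (b <? a) ⊎-dec ((b ≟ a) ×-dec (o Bool.≟ false))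

listsUpTo : ∀ {A : Set} → ℕ → List A → List (List A)
listsUpTo zero    xs = [] ∷ []
listsUpTo (suc k) xs = [] ∷ cartesianProductWith _∷_ xs (listsUpTo k xs)

listsUpTo-unique : ∀ {A : Set} k {xs : List A} → Unique xs → Unique (listsUpTo k xs)
listsUpTo-unique zero    xs! = [] AllPairs.∷ AllPairs.[]
listsUpTo-unique (suc k) {xs} xs! =
  All.tabulate nonempty AllPairs.∷
    Unique.cartesianProductWith⁺ _∷_ List.∷-injective xs! (listsUpTo-unique k xs!)
  where
  nonempty : ∀ {ys} → ys ∈ cartesianProductWith _∷_ xs (listsUpTo k xs) → [] ≢ ys
  nonempty ys∈ refl with ∈-cartesianProductWith⁻ _∷_ xs (listsUpTo k xs) ys∈
  ... | _ , _ , _ , _ , ()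

listsUpTo-complete : ∀ {A : Set} k {xs : List A} (ys : List A) →
  length ys ≤ k → All (_∈ xs) ys → ys ∈ listsUpTo k xs
listsUpTo-complete zero    []       _       _          = here refl
listsUpTo-complete (suc k) []       _       _          = here refl
listsUpTo-complete (suc k) (y ∷ ys) (s≤s l) (y∈ ∷ ys∈) =
  there (∈-cartesianProductWith⁺ _∷_ y∈ (listsUpTo-complete k ys l ys∈))

partsUpTo : ℕ → List Part
partsUpTo n = cartesianProduct (upTo (suc n)) (true ∷ false ∷ [])

partsUpTo-unique : ∀ n → Unique (partsUpTo n)
partsUpTo-unique n = Unique.cartesianProduct⁺ (Unique.upTo⁺ (suc n))
  (((λ ()) ∷ []) AllPairs.∷ [] AllPairs.∷ AllPairs.[])

partsUpTo-complete : ∀ n (ps : List Part) → sum (map proj₁ ps) ≤ n → All (_∈ partsUpTo n) ps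
partsUpTo-complete n []             _ = []
partsUpTo-complete n ((a , o) ∷ ps) l =
  ∈-cartesianProduct⁺ (∈-upTo⁺ (s≤s (≤-trans (m≤m+n a _) l))) (bool∈ o)
    ∷ partsUpTo-complete n ps (≤-trans (m≤n+m _ a) l)
  where
  bool∈ : ∀ b → b ∈ true ∷ false ∷ []
  bool∈ true  = here refl
  bool∈ false = there (here refl)

length≤sum : ∀ (ps : List Part) → All (λ p → 0 < proj₁ p) ps → length ps ≤ sum (map proj₁ ps)
length≤sum []       []           = z≤n
length≤sum (p ∷ ps) (0<p ∷ 0<ps) = +-mono-≤ 0<p (length≤sum ps 0<ps)

overpartitions : ∀ n → Enumeration (IsOverpartition n)
overpartitions n = filterEnumeration (isOverpartition? n)
  (listsUpTo n (partsUpTo n))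
  (listsUpTo-unique n (partsUpTo-unique n))
  (λ { ps (0<ps , _ , sum≡n) → listsUpTo-complete n ps
         (≤-trans (length≤sum ps 0<ps) (≤-reflexive sum≡n))
         (partsUpTo-complete n ps (≤-reflexive sum≡n)) })

p̄ : ℕ → ℕ
p̄ n = Enumeration.size (overpartitions n)

------------------------------------------------------------------------
-- Representations as sums of squares

sumOfSquares : ∀ {k} → Vec ℤ k → ℤ
sumOfSquares xs = Vec.foldr′ ℤ._+_ 0ℤ (Vec.map (λ x → x ℤ.* x) xs)

IsRepresentation : ∀ k → ℕ → Vec ℤ k → Set
IsRepresentation k n xs = sumOfSquares xs ≡ + n

-- The integers x with ∣ x ∣ ≤ n.
interval : ℕ → List ℤ
interval n = map +_ (upTo (suc n)) ++ map -[1+_] (upTo n)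

interval-unique : ∀ n → Unique (interval n)
interval-unique n = Unique.++⁺
  (Unique.map⁺ ℤ.+-injective (Unique.upTo⁺ (suc n)))
  (Unique.map⁺ ℤ.-[1+-injective (Unique.upTo⁺ n))
  disjoint
  where
  disjoint : ∀ {x} → x ∈ map +_ (upTo (suc n)) × x ∈ map -[1+_] (upTo n) → ⊥
  disjoint (x∈₁ , x∈₂) with ∈-map⁻ +_ x∈₁ | ∈-map⁻ -[1+_] x∈₂
  ... | _ , _ , refl | _ , _ , ()

interval-complete : ∀ n x → ∣ x ∣ ≤ n → x ∈ interval n
interval-complete n (+ a)      l = ∈-++⁺ˡ (∈-map⁺ +_ (∈-upTo⁺ (s≤s l)))
interval-complete n (-[1+ a ]) l = ∈-++⁺ʳ (map +_ (upTo (suc n))) (∈-map⁺ -[1+_] (∈-upTo⁺ l))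

box : ∀ {A : Set} k → List A → List (Vec A k)
box zero    xs = [] ∷ []
box (suc k) xs = cartesianProductWith _∷_ xs (box k xs)

box-unique : ∀ {A : Set} k {xs : List A} → Unique xs → Unique (box k xs)
box-unique zero    xs! = [] AllPairs.∷ AllPairs.[]
box-unique (suc k) xs! = Unique.cartesianProductWith⁺ _∷_ Vec.∷-injective xs! (box-unique k xs!)

box-complete : ∀ {A : Set} {k} {xs : List A} {ys : Vec A k} →
  VecAll.All (_∈ xs) ys → ys ∈ box k xs
box-complete VecAll.[]           = here refl
box-complete (y∈ VecAll.∷ ys∈) = ∈-cartesianProductWith⁺ _∷_ y∈ (box-complete ys∈)

sumOfSquaresℕ : ∀ {k} → Vec ℤ k → ℕ
sumOfSquaresℕ []       = 0
sumOfSquaresℕ (x ∷ xs) = ∣ x ∣ * ∣ x ∣ + sumOfSquaresℕ xs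

square-abs : ∀ x → x ℤ.* x ≡ + (∣ x ∣ * ∣ x ∣)
square-abs (+ a)      = sym (ℤ.pos-* a a)
square-abs (-[1+ a ]) = refl

sumOfSquares-abs : ∀ {k} (xs : Vec ℤ k) → sumOfSquares xs ≡ + sumOfSquaresℕ xs
sumOfSquares-abs []       = refl
sumOfSquares-abs (x ∷ xs) = cong₂ ℤ._+_ (square-abs x) (sumOfSquares-abs xs)

entries-bounded : ∀ {k} n (xs : Vec ℤ k) → sumOfSquaresℕ xs ≤ n → VecAll.All (_∈ interval n) xs
entries-bounded n []       _ = VecAll.[]
entries-bounded n (x ∷ xs) l =
  interval-complete n x (≤-trans (m≤m² ∣ x ∣) (≤-trans (m≤m+n _ _) l))
    VecAll.∷ entries-bounded n xs (≤-trans (m≤n+m _ (∣ x ∣ * ∣ x ∣)) l)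
  where
  m≤m² : ∀ m → m ≤ m * m
  m≤m² zero    = z≤n
  m≤m² (suc m) = m≤m*n (suc m) (suc m)

representations : ∀ k n → Enumeration (IsRepresentation k n)
representations k n = filterEnumeration (λ xs → sumOfSquares xs ℤ.≟ + n)
  (box k (interval n))
  (box-unique k (interval-unique n))
  (λ xs rep → box-complete (entries-bounded n xs
     (≤-reflexive (ℤ.+-injective (trans (sym (sumOfSquares-abs xs)) rep)))))

r : ℕ → ℕ → ℕ
r k n = Enumeration.size (representations k n)

{-# OPTIONS --safe #-}
module Submission where

-- Put ψ(q) = Σ (-1)ⁿ p̄(n) qⁿ, the inverse of the theta series φ(q) (Gauss), and
-- write U for the operator keeping the coefficients at multiples of 3, V for
-- q ↦ q³.  From φ³ ≡ V φ (mod 3) follows φ⁹ ≡ (V φ)³ (mod 9), so ψ (V φ)³ ≡ φ⁸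
-- and, applying U, φ³ · U ψ ≡ U φ⁸.  It remains to see U φ⁸ ≡ φ⁸ (mod 9), for
-- then U ψ ≡ φ⁵.  With the 3-dissection φ = V φ₃ + 2q V ω, φ₃ = V φ, the series
-- U φ⁸ is a polynomial in φ₃, q and ω, and so is φ⁸, because
--     φ⁴ = φ₃⁴ + 8 q φ₃ ω³ :
-- the lattice of integer vectors reducing modulo 3 to the tetracode is √3 ℤ⁴
-- up to an isometry.

open import Defs
open import Algebra using (CommutativeRing)
import Algebra.Properties.Semiring.Exp as Exp
import Algebra.Solver.Ring as RingSolver
open import Algebra.Solver.Ring.AlmostCommutativeRing using (fromCommutativeRing; _-Raw-AlmostCommutative⟶_)
open import Data.Bool using (true; false)
import Data.Bool.Properties as Bool
open import Data.Empty using (⊥; ⊥-elim)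
open import Data.Fin as Fin using (Fin; toℕ)
open import Data.Fin.Patterns using (0F; 1F; 2F)
open import Data.Integer using (ℤ; +_; -[1+_]; 0ℤ; 1ℤ; -1ℤ; ∣_∣) renaming (_+_ to _+ℤ_; _*_ to _*ℤ_; _-_ to _-ℤ_; -_ to -ℤ_; _^_ to _^ℤ_)
import Data.Integer.DivMod as ℤ
import Data.Integer.Divisibility.Signed as Signed
import Data.Integer.Properties as ℤ
open import Data.Integer.Tactic.RingSolver using (solve-∀)
open import Data.List using (List; []; _∷_; _++_; length; map; filter; cartesianProduct)
open import Data.List.Membership.Propositional using (_∈_)
open import Data.List.Membership.Propositional.Properties
open import Data.List.Membership.Propositional.Properties.WithK using (unique∧set⇒bag)
import Data.List.Properties as List
open import Data.List.Relation.Binary.BagAndSetEquality using (∼bag⇒↭)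
open import Data.List.Relation.Binary.Permutation.Propositional.Properties using (↭-length)
import Data.List.Relation.Unary.All as All
import Data.List.Relation.Unary.AllPairs as AllPairs
open import Data.List.Relation.Unary.Any using (here; there)
import Data.List.Relation.Unary.Linked as Linked
import Data.List.Relation.Unary.Unique.Propositional.Properties as Unique
open import Data.Maybe using (Maybe; just; nothing)
open import Data.Nat using (ℕ; zero; suc; _+_; _*_; _≤_; _<_; _≥_; z≤n; s≤s; _<?_; _≤?_; _≟_; pred)
import Data.Nat.Properties as ℕ
open import Data.Product using (_×_; _,_; proj₁; proj₂; ∃-syntax; map₁; map₂)
open import Data.Sum as Sum using (_⊎_; inj₁; inj₂; [_,_]′)
open import Data.Unit using (⊤; tt)
open import Data.Vec as Vec using (Vec; []; _∷_)
import Data.Vec.Properties as Vec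
open import Function using (mk⇔; _∘_; id; Equivalence)
open import Level using (0ℓ)
open import Relation.Binary.PropositionalEquality using (_≡_; _≢_; refl; sym; trans; cong; cong₂; subst; module ≡-Reasoning)
import Relation.Binary.Reasoning.Setoid as SetoidReasoning
open import Relation.Nullary using (¬_; yes; no)
open import Relation.Nullary.Decidable using (_×-dec_; _⊎-dec_; from-no)
open import Relation.Unary using (Decidable)

-- Formal power series over ℤ

-- The dissection alone cannot compare U φ⁸ with φ⁸: it expresses φ through `V φ₃` and `V ω`, while
-- U strips the V and leaves a polynomial in `φ₃` and `ω`. What bridges the gap is an algebraic
-- relation between φ itself and `φ₃`, `ω`; squaring the quartic one gives φ⁸. The outcome amounts
-- to the exact equation U φ⁸ = 28 φ⁸ - 27 φ₃⁸, the Hecke relation at 3 in weight 4, with 28 = 1 +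
-- 3³. This explains the ninth power: it is a cube of a cube, as the lift from 3 to 9 demands, and
-- cancelling one factor against ψ leaves the power 8, where that relation holds. Infinite products
-- and sums are avoided: φ ψ = 1 is checked one coefficient at a time, and the coefficient of qⁿ
-- sees only parts at most n and roots of absolute value at most n. Congruences modulo 9 are carried
-- as equations with an explicit error series times `const (+ 9)`, so that they can be multiplied,
-- passed through U and fed to the ring solver.

Series : Set
Series = ℕ → ℤ

infix 4 _≈_
-- A record rather than a bare function type, so that unification can read off both series from the
-- type of an equation.
record _≈_ (f g : Series) : Set where
  constructor pointwise
  field at : ∀ n → f n ≡ g n
open _≈_

infixl 6 _⊕_
infixl 7 _⊛_
infix  8 ⊖_

_⊕_ : Series → Series → Series
(f ⊕ g) n = f n +ℤ g n

⊖_ : Series → Series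
(⊖ f) n = -ℤ f n

tail : Series → Series
tail f n = f (suc n)

-- The Cauchy product through f = f 0 + q · `tail f`; this avoids index sums and subtraction, and
-- later counting constructions copy the same recursion.
_⊛_ : Series → Series → Series
(f ⊛ g) zero    = f 0 *ℤ g 0
(f ⊛ g) (suc n) = f 0 *ℤ g (suc n) +ℤ (tail f ⊛ g) n

const : ℤ → Series
const c zero    = c
const c (suc _) = 0ℤ

scale : ℤ → Series → Series
scale c f n = c *ℤ f n

shift : Series → Series
shift f zero    = 0ℤ
shift f (suc n) = f n

≈-refl : ∀ {f} → f ≈ f
≈-refl = pointwise λ _ → refl

≈-sym : ∀ {f g} → f ≈ g → g ≈ f
≈-sym p = pointwise λ n → sym (at p n)

≈-trans : ∀ {f g h} → f ≈ g → g ≈ h → f ≈ h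
≈-trans p q = pointwise λ n → trans (at p n) (at q n)

-- A coefficient of degree n involves only coefficients up to n. This bounded form is what allows
-- truncations to replace φ and the generating function of overpartitions.
⊛-cong-≤ : ∀ {f f′ g g′} n → (∀ k → k ≤ n → f k ≡ f′ k) → (∀ k → k ≤ n → g k ≡ g′ k) →
           (f ⊛ g) n ≡ (f′ ⊛ g′) n
⊛-cong-≤ zero    p q = cong₂ _*ℤ_ (p 0 z≤n) (q 0 z≤n)
⊛-cong-≤ (suc n) p q = cong₂ _+ℤ_ (cong₂ _*ℤ_ (p 0 z≤n) (q (suc n) ℕ.≤-refl))
  (⊛-cong-≤ n (λ k k≤n → p (suc k) (s≤s k≤n)) (λ k k≤n → q k (ℕ.m≤n⇒m≤1+n k≤n)))

⊛-cong : ∀ {f f′ g g′} → f ≈ f′ → g ≈ g′ → f ⊛ g ≈ f′ ⊛ g′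
⊛-cong p q = pointwise λ n → ⊛-cong-≤ n (λ k _ → at p k) (λ k _ → at q k)

⊕-congˡ : ∀ f {g h} → g ≈ h → f ⊕ g ≈ f ⊕ h
⊕-congˡ f p = pointwise λ n → cong (f n +ℤ_) (at p n)

⊛-distribʳ-at : ∀ h f g n → ((f ⊕ g) ⊛ h) n ≡ (f ⊛ h) n +ℤ (g ⊛ h) n
⊛-distribʳ-at h f g zero    = ℤ.*-distribʳ-+ (h 0) (f 0) (g 0)
⊛-distribʳ-at h f g (suc n) =
  trans (cong ((f 0 +ℤ g 0) *ℤ h (suc n) +ℤ_) (⊛-distribʳ-at h (tail f) (tail g) n))
        (rearrange (f 0) (g 0) (h (suc n)) ((tail f ⊛ h) n) ((tail g ⊛ h) n))
  where
  rearrange : ∀ a b c x y → (a +ℤ b) *ℤ c +ℤ (x +ℤ y) ≡ (a *ℤ c +ℤ x) +ℤ (b *ℤ c +ℤ y)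
  rearrange = solve-∀

-- The defining recursion peels the left factor; peeling the right one instead is what commutativity
-- needs.
⊛-suc : ∀ f g n → (f ⊛ g) (suc n) ≡ f (suc n) *ℤ g 0 +ℤ (f ⊛ tail g) n
⊛-suc f g zero    = ℤ.+-comm (f 0 *ℤ g 1) _
⊛-suc f g (suc n) =
  trans (cong (f 0 *ℤ g (2 + n) +ℤ_) (⊛-suc (tail f) g n))
        (rearrange (f 0 *ℤ g (2 + n)) (f (2 + n) *ℤ g 0) ((tail f ⊛ tail g) n))
  where
  rearrange : ∀ a b c → a +ℤ (b +ℤ c) ≡ b +ℤ (a +ℤ c)
  rearrange = solve-∀

⊛-comm-at : ∀ f g n → (f ⊛ g) n ≡ (g ⊛ f) n
⊛-comm-at f g zero    = ℤ.*-comm (f 0) (g 0)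
⊛-comm-at f g (suc n) =
  trans (cong₂ _+ℤ_ (ℤ.*-comm (f 0) (g (suc n))) (⊛-comm-at (tail f) g n)) (sym (⊛-suc g f n))

scale-⊛ : ∀ c f g n → (scale c f ⊛ g) n ≡ c *ℤ (f ⊛ g) n
scale-⊛ c f g zero    = ℤ.*-assoc c (f 0) (g 0)
scale-⊛ c f g (suc n) =
  trans (cong (c *ℤ f 0 *ℤ g (suc n) +ℤ_) (scale-⊛ c (tail f) g n))
        (rearrange c (f 0) (g (suc n)) ((tail f ⊛ g) n))
  where
  rearrange : ∀ c a b x → c *ℤ a *ℤ b +ℤ c *ℤ x ≡ c *ℤ (a *ℤ b +ℤ x)
  rearrange = solve-∀

⊛-assoc-at : ∀ f g h n → ((f ⊛ g) ⊛ h) n ≡ (f ⊛ (g ⊛ h)) n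
⊛-assoc-at f g h zero    = ℤ.*-assoc (f 0) (g 0) (h 0)
⊛-assoc-at f g h (suc n) = begin
  f 0 *ℤ g 0 *ℤ h (suc n) +ℤ ((scale (f 0) (tail g) ⊕ (tail f ⊛ g)) ⊛ h) n
    ≡⟨ cong (f 0 *ℤ g 0 *ℤ h (suc n) +ℤ_) (⊛-distribʳ-at h (scale (f 0) (tail g)) (tail f ⊛ g) n) ⟩
  f 0 *ℤ g 0 *ℤ h (suc n) +ℤ ((scale (f 0) (tail g) ⊛ h) n +ℤ ((tail f ⊛ g) ⊛ h) n)
    ≡⟨ cong₂ (λ x y → f 0 *ℤ g 0 *ℤ h (suc n) +ℤ (x +ℤ y))
             (scale-⊛ (f 0) (tail g) h n) (⊛-assoc-at (tail f) g h n) ⟩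
  f 0 *ℤ g 0 *ℤ h (suc n) +ℤ (f 0 *ℤ (tail g ⊛ h) n +ℤ (tail f ⊛ (g ⊛ h)) n)
    ≡⟨ rearrange (f 0) (g 0) (h (suc n)) ((tail g ⊛ h) n) ((tail f ⊛ (g ⊛ h)) n) ⟩
  f 0 *ℤ (g 0 *ℤ h (suc n) +ℤ (tail g ⊛ h) n) +ℤ (tail f ⊛ (g ⊛ h)) n ∎
  where
  open ≡-Reasoning
  rearrange : ∀ a b c x y → a *ℤ b *ℤ c +ℤ (a *ℤ x +ℤ y) ≡ a *ℤ (b *ℤ c +ℤ x) +ℤ y
  rearrange = solve-∀

0⊛ : ∀ {f} → (∀ n → f n ≡ 0ℤ) → ∀ g n → (f ⊛ g) n ≡ 0ℤ
0⊛ p g zero    = trans (cong (_*ℤ g 0) (p 0)) (ℤ.*-zeroˡ (g 0))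
0⊛ p g (suc n) = trans (cong₂ _+ℤ_ (trans (cong (_*ℤ g (suc n)) (p 0)) (ℤ.*-zeroˡ (g (suc n))))
                                   (0⊛ (λ k → p (suc k)) g n)) refl

const-⊛ : ∀ c f n → (const c ⊛ f) n ≡ c *ℤ f n
const-⊛ c f zero    = refl
const-⊛ c f (suc n) =
  trans (cong (c *ℤ f (suc n) +ℤ_) (0⊛ {tail (const c)} (λ _ → refl) f n)) (ℤ.+-identityʳ _)

seriesRing : CommutativeRing 0ℓ 0ℓ
seriesRing = record
  { Carrier = Series ; _≈_ = _≈_ ; _+_ = _⊕_ ; _*_ = _⊛_ ; -_ = ⊖_ ; 0# = const 0ℤ ; 1# = const 1ℤ
  ; isCommutativeRing = record
    { isRing = record
      { +-isAbelianGroup = record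
        { isGroup = record
          { isMonoid = record
            { isSemigroup = record
              { isMagma = record
                { isEquivalence = record { refl = ≈-refl ; sym = ≈-sym ; trans = ≈-trans }
                ; ∙-cong = λ p q → pointwise λ n → cong₂ _+ℤ_ (at p n) (at q n) }
              ; assoc = λ f g h → pointwise λ n → ℤ.+-assoc (f n) (g n) (h n) }
            ; identity = (λ f → pointwise λ { zero → ℤ.+-identityˡ _ ; (suc n) → ℤ.+-identityˡ _ })
                       , (λ f → pointwise λ { zero → ℤ.+-identityʳ _ ; (suc n) → ℤ.+-identityʳ _ }) }
          ; inverse = (λ f → pointwise λ { zero → ℤ.+-inverseˡ (f 0) ; (suc n) → ℤ.+-inverseˡ (f (suc n)) })
                    , (λ f → pointwise λ { zero → ℤ.+-inverseʳ (f 0) ; (suc n) → ℤ.+-inverseʳ (f (suc n)) })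
          ; ⁻¹-cong = λ p → pointwise λ n → cong -ℤ_ (at p n) }
        ; comm = λ f g → pointwise λ n → ℤ.+-comm (f n) (g n) }
      ; *-cong = ⊛-cong
      ; *-assoc = λ f g h → pointwise (⊛-assoc-at f g h)
      ; *-identity = identityˡ , λ f → ≈-trans (⊛-comm f (const 1ℤ)) (identityˡ f)
      ; distrib = (λ h f g → ≈-trans (⊛-comm h (f ⊕ g)) (≈-trans (distribʳ h f g)
                    (pointwise λ n → cong₂ _+ℤ_ (⊛-comm-at f h n) (⊛-comm-at g h n))))
                , distribʳ }
    ; *-comm = ⊛-comm } }
  where
  ⊛-comm : ∀ f g → f ⊛ g ≈ g ⊛ f
  ⊛-comm f g = pointwise (⊛-comm-at f g)
  identityˡ : ∀ f → const 1ℤ ⊛ f ≈ f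
  identityˡ f = pointwise λ n → trans (const-⊛ 1ℤ f n) (ℤ.*-identityˡ (f n))
  distribʳ : ∀ h f g → (f ⊕ g) ⊛ h ≈ f ⊛ h ⊕ g ⊛ h
  distribʳ h f g = pointwise (⊛-distribʳ-at h f g)

open CommutativeRing seriesRing using (setoid)
  renaming (+-cong to ⊕-cong; *-comm to ⊛-comm; *-assoc to ⊛-assoc;
            *-identityˡ to ⊛-identityˡ; distribˡ to ⊛-distribˡ)

ℤ-to-series : CommutativeRing.rawRing ℤ.+-*-commutativeRing -Raw-AlmostCommutative⟶ fromCommutativeRing seriesRing
ℤ-to-series = record
  { ⟦_⟧    = const
  ; +-homo = λ a b → pointwise λ { zero → refl ; (suc n) → refl }
  ; *-homo = λ a b → pointwise λ
      { zero → refl ; (suc n) → sym (trans (const-⊛ a (const b) (suc n)) (ℤ.*-zeroʳ a)) }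
  ; -‿homo = λ a → pointwise λ { zero → refl ; (suc n) → refl }
  ; 0-homo = ≈-refl
  ; 1-homo = ≈-refl
  }

const-≟ : ∀ a b → Maybe (const a ≈ const b)
const-≟ a b with a ℤ.≟ b
... | yes refl = just ≈-refl
... | no _     = nothing

module Solver = RingSolver (CommutativeRing.rawRing ℤ.+-*-commutativeRing) (fromCommutativeRing seriesRing)
  ℤ-to-series const-≟
open Solver using (solve; _:=_; _:+_; _:*_; :-_; _:-_; con; _:^_)
module ≈-Reasoning = SetoidReasoning setoid

-- Substitution q ↦ q³ and 3-dissection

open Exp (CommutativeRing.semiring seriesRing) using (^-homo-*) renaming (_^_ to _^ˢ_; ^-congˡ to ^ˢ-congˡ)

X : ℕ → Series
X zero    = const 1ℤ
X (suc k) = shift (X k)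

shift-⊛ : ∀ f g → shift f ⊛ g ≈ shift (f ⊛ g)
shift-⊛ f g = pointwise λ
  { zero → ℤ.*-zeroˡ (g 0)
  ; (suc n) → trans (cong (_+ℤ (f ⊛ g) n) (ℤ.*-zeroˡ (g (suc n)))) (ℤ.+-identityˡ _) }

shift-cong : ∀ {f g} → f ≈ g → shift f ≈ shift g
shift-cong p = pointwise λ { zero → refl ; (suc n) → at p n }

X-+ : ∀ a b → X (a + b) ≈ X a ⊛ X b
X-+ zero    b = ≈-sym (⊛-identityˡ (X b))
X-+ (suc a) b = ≈-trans (shift-cong (X-+ a b)) (≈-sym (shift-⊛ (X a) (X b)))

X-⊛-< : ∀ k f n → n < k → (X k ⊛ f) n ≡ 0ℤ
X-⊛-< (suc k) f zero    _         = at (shift-⊛ (X k) f) 0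
X-⊛-< (suc k) f (suc n) (s≤s n<k) = trans (at (shift-⊛ (X k) f) (suc n)) (X-⊛-< k f n n<k)

X1-⊛ : ∀ f → X 1 ⊛ f ≈ shift f
X1-⊛ f = ≈-trans (shift-⊛ (const 1ℤ) f) (shift-cong (⊛-identityˡ f))

head-tail : ∀ f → f ≈ const (f 0) ⊕ X 1 ⊛ tail f
head-tail f = pointwise λ
  { zero → sym (trans (cong (f 0 +ℤ_) (at (X1-⊛ (tail f)) 0)) (ℤ.+-identityʳ _))
  ; (suc n) → sym (trans (cong (0ℤ +ℤ_) (at (X1-⊛ (tail f)) (suc n))) (ℤ.+-identityˡ _)) }

-- V f = f(q³).
V : Series → Series
V f 0 = f 0
V f 1 = 0ℤ
V f 2 = 0ℤ
V f (suc (suc (suc n))) = V (tail f) n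

U : Series → Series
U f n = f (n * 3)

V-cong-at : ∀ {f g} → f ≈ g → ∀ n → V f n ≡ V g n
V-cong-at p 0 = at p 0
V-cong-at p 1 = refl
V-cong-at p 2 = refl
V-cong-at p (suc (suc (suc n))) = V-cong-at (pointwise λ k → at p (suc k)) n

V-cong : ∀ {f g} → f ≈ g → V f ≈ V g
V-cong p = pointwise (V-cong-at p)

U-cong : ∀ {f g} → f ≈ g → U f ≈ U g
U-cong p = pointwise λ n → at p (n * 3)

V-⊕-at : ∀ f g n → V (f ⊕ g) n ≡ V f n +ℤ V g n
V-⊕-at f g 0 = refl
V-⊕-at f g 1 = refl
V-⊕-at f g 2 = refl
V-⊕-at f g (suc (suc (suc n))) = V-⊕-at (tail f) (tail g) n

V-scale-at : ∀ c f n → V (scale c f) n ≡ c *ℤ V f n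
V-scale-at c f 0 = refl
V-scale-at c f 1 = sym (ℤ.*-zeroʳ c)
V-scale-at c f 2 = sym (ℤ.*-zeroʳ c)
V-scale-at c f (suc (suc (suc n))) = V-scale-at c (tail f) n

V-⊛-at : ∀ f g n → V (f ⊛ g) n ≡ (V f ⊛ V g) n
V-⊛-at f g 0 = refl
V-⊛-at f g 1 = vanish (f 0) (g 0)
  where
  vanish : ∀ a b → 0ℤ ≡ a *ℤ 0ℤ +ℤ 0ℤ *ℤ b
  vanish = solve-∀
V-⊛-at f g 2 = vanish (f 0) (g 0)
  where
  vanish : ∀ a b → 0ℤ ≡ a *ℤ 0ℤ +ℤ (0ℤ +ℤ 0ℤ *ℤ b)
  vanish = solve-∀
V-⊛-at f g (suc (suc (suc n))) = begin
  V (scale (f 0) (tail g) ⊕ tail f ⊛ g) n       ≡⟨ V-⊕-at (scale (f 0) (tail g)) (tail f ⊛ g) n ⟩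
  V (scale (f 0) (tail g)) n +ℤ V (tail f ⊛ g) n ≡⟨ cong₂ _+ℤ_ (V-scale-at (f 0) (tail g) n) (V-⊛-at (tail f) g n) ⟩
  f 0 *ℤ V (tail g) n +ℤ (V (tail f) ⊛ V g) n    ≡⟨ pad (f 0 *ℤ V (tail g) n) (V g (2 + n)) (V g (1 + n)) _ ⟩
  (V f ⊛ V g) (3 + n) ∎
  where
  open ≡-Reasoning
  pad : ∀ a x y b → a +ℤ b ≡ a +ℤ (0ℤ *ℤ x +ℤ (0ℤ *ℤ y +ℤ b))
  pad = solve-∀

V-⊕ : ∀ f g → V (f ⊕ g) ≈ V f ⊕ V g
V-⊕ f g = pointwise (V-⊕-at f g)

V-⊛ : ∀ f g → V (f ⊛ g) ≈ V f ⊛ V g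
V-⊛ f g = pointwise (V-⊛-at f g)

-- U is linear over series in q³. Three coefficients of `V f` are consumed at a time, and two of
-- them are zero.
U-V⊛-at : ∀ f g n → U (V f ⊛ g) n ≡ (f ⊛ U g) n
U-V⊛-at f g zero    = refl
U-V⊛-at f g (suc n) =
  trans (unpad (f 0 *ℤ g (3 + n * 3)) (g (2 + n * 3)) (g (1 + n * 3)) _)
        (cong (f 0 *ℤ g (3 + n * 3) +ℤ_) (U-V⊛-at (tail f) g n))
  where
  unpad : ∀ a x y b → a +ℤ (0ℤ *ℤ x +ℤ (0ℤ *ℤ y +ℤ b)) ≡ a +ℤ b
  unpad = solve-∀

U-V⊛ : ∀ f g → U (V f ⊛ g) ≈ f ⊛ U g
U-V⊛ f g = pointwise (U-V⊛-at f g)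

V-at-*3 : ∀ f n → V f (n * 3) ≡ f n
V-at-*3 f zero    = refl
V-at-*3 f (suc n) = V-at-*3 (tail f) n

V-at-1+*3 : ∀ f n → V f (1 + n * 3) ≡ 0ℤ
V-at-1+*3 f zero    = refl
V-at-1+*3 f (suc n) = V-at-1+*3 (tail f) n

V-at-2+*3 : ∀ f n → V f (2 + n * 3) ≡ 0ℤ
V-at-2+*3 f zero    = refl
V-at-2+*3 f (suc n) = V-at-2+*3 (tail f) n

V-U-at : ∀ f → (∀ m → f (1 + m * 3) ≡ 0ℤ) → (∀ m → f (2 + m * 3) ≡ 0ℤ) → ∀ n → V (U f) n ≡ f n
V-U-at f p₁ p₂ 0 = refl
V-U-at f p₁ p₂ 1 = sym (p₁ 0)
V-U-at f p₁ p₂ 2 = sym (p₂ 0)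
V-U-at f p₁ p₂ (suc (suc (suc n))) =
  V-U-at (tail (tail (tail f))) (λ m → p₁ (suc m)) (λ m → p₂ (suc m)) n

V-U : ∀ f → (∀ m → f (1 + m * 3) ≡ 0ℤ) → (∀ m → f (2 + m * 3) ≡ 0ℤ) → V (U f) ≈ f
V-U f p₁ p₂ = pointwise (V-U-at f p₁ p₂)

V-const : ∀ c → V (const c) ≈ const c
V-const c = pointwise λ { 0 → refl ; 1 → refl ; 2 → refl ; (suc (suc (suc n))) → V-0 n }
  where
  V-0 : ∀ n → V (λ _ → 0ℤ) n ≡ 0ℤ
  V-0 0 = refl
  V-0 1 = refl
  V-0 2 = refl
  V-0 (suc (suc (suc n))) = V-0 n

V-X1 : V (X 1) ≈ X 1 ^ˢ 3
V-X1 = ≈-trans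
  (pointwise λ { 0 → refl ; 1 → refl ; 2 → refl ; (suc (suc (suc n))) → at (V-const 1ℤ) n })
  (≈-sym (≈-trans (⊛-cong (≈-refl {X 1}) (≈-trans (⊛-cong (≈-refl {X 1}) (X1-⊛ (const 1ℤ))) (X1-⊛ (X 1)))) (X1-⊛ (X 2))))

dissect : Series → Series → Series → Series
dissect a b c = V a ⊕ X 1 ⊛ V b ⊕ X 1 ^ˢ 2 ⊛ V c

dissect-cong : ∀ {a a′ b b′ c c′} → a ≈ a′ → b ≈ b′ → c ≈ c′ → dissect a b c ≈ dissect a′ b′ c′
dissect-cong p q r = ⊕-cong (⊕-cong (V-cong p) (⊛-cong ≈-refl (V-cong q))) (⊛-cong (≈-refl {X 1 ^ˢ 2}) (V-cong r))

-- Degrees add modulo 3. A product that reaches degree 3 or 4 carries over a factor q³ = V q, which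
-- becomes the `X 1` inside a component.
dissect-⊛ : ∀ a b c a′ b′ c′ → dissect a b c ⊛ dissect a′ b′ c′ ≈
  dissect (a ⊛ a′ ⊕ X 1 ⊛ (b ⊛ c′ ⊕ c ⊛ b′)) (a ⊛ b′ ⊕ b ⊛ a′ ⊕ X 1 ⊛ (c ⊛ c′)) (a ⊛ c′ ⊕ b ⊛ b′ ⊕ c ⊛ a′)
dissect-⊛ a b c a′ b′ c′ = ≈-trans
  (solve 7 (λ x a b c a′ b′ c′ →
      (a :+ x :* b :+ x :^ 2 :* c) :* (a′ :+ x :* b′ :+ x :^ 2 :* c′) :=
      (a :* a′ :+ x :^ 3 :* (b :* c′ :+ c :* b′)) :+ x :* (a :* b′ :+ b :* a′ :+ x :^ 3 :* (c :* c′))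
        :+ x :^ 2 :* (a :* c′ :+ b :* b′ :+ c :* a′))
    ≈-refl (X 1) (V a) (V b) (V c) (V a′) (V b′) (V c′))
  (≈-sym (⊕-cong (⊕-cong
    (V-plus (V-⊛ a a′) (V-q (V-plus (V-⊛ b c′) (V-⊛ c b′))))
    (⊛-cong (≈-refl {X 1}) (V-plus (V-plus (V-⊛ a b′) (V-⊛ b a′)) (V-q (V-⊛ c c′)))))
    (⊛-cong (≈-refl {X 1 ^ˢ 2}) (V-plus (V-plus (V-⊛ a c′) (V-⊛ b b′)) (V-⊛ c a′)))))
  where
  V-plus : ∀ {f g f′ g′} → V f ≈ f′ → V g ≈ g′ → V (f ⊕ g) ≈ f′ ⊕ g′
  V-plus {f} {g} p q = ≈-trans (V-⊕ f g) (⊕-cong p q)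
  V-q : ∀ {f f′} → V f ≈ f′ → V (X 1 ⊛ f) ≈ X 1 ^ˢ 3 ⊛ f′
  V-q {f} p = ≈-trans (V-⊛ (X 1) f) (⊛-cong V-X1 p)

U-dissect : ∀ a b c → U (dissect a b c) ≈ a
U-dissect a b c = pointwise λ n → trans
  (cong₂ _+ℤ_ (cong₂ _+ℤ_ (V-at-*3 a n) (trans (at (X1-⊛ (V b)) (n * 3)) (shifted n)))
     (trans (at (≈-trans (⊛-cong (⊛-cong (≈-refl {X 1}) (X1-⊛ (const 1ℤ))) (≈-refl {V c})) (≈-trans (⊛-cong (X1-⊛ (X 1)) ≈-refl)
        (≈-trans (shift-⊛ (X 1) (V c)) (shift-cong (X1-⊛ (V c)))))) (n * 3)) (shifted² n)))
  (trans (ℤ.+-identityʳ _) (ℤ.+-identityʳ _))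
  where
  shifted : ∀ n → shift (V b) (n * 3) ≡ 0ℤ
  shifted zero    = refl
  shifted (suc n) = V-at-2+*3 b n
  shifted² : ∀ n → shift (shift (V c)) (n * 3) ≡ 0ℤ
  shifted² zero    = refl
  shifted² (suc n) = V-at-1+*3 c n

-- Cubes modulo 3 and ninth powers modulo 9

mod3 : ∀ x → ∃[ c ] ∃[ t ] x ≡ + toℕ {3} c +ℤ + 3 *ℤ t
mod3 x with x ℤ.%ℕ 3 | ℤ.n%ℕd<d x 3 | ℤ.a≡a%ℕn+[a/ℕn]*n x 3
... | 0 | _ | eq = 0F , x ℤ./ℕ 3 , trans eq (cong (+ 0 +ℤ_) (ℤ.*-comm (x ℤ./ℕ 3) (+ 3)))
... | 1 | _ | eq = 1F , x ℤ./ℕ 3 , trans eq (cong (+ 1 +ℤ_) (ℤ.*-comm (x ℤ./ℕ 3) (+ 3)))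
... | 2 | _ | eq = 2F , x ℤ./ℕ 3 , trans eq (cong (+ 2 +ℤ_) (ℤ.*-comm (x ℤ./ℕ 3) (+ 3)))
... | suc (suc (suc _)) | s≤s (s≤s (s≤s ())) | _

fermat3 : ∀ x → ∃[ k ] x *ℤ x *ℤ x ≡ x +ℤ + 3 *ℤ k
fermat3 x with mod3 x
... | 0F , t , refl = _ , expand t
  where
  expand : ∀ t → let y = + 0 +ℤ + 3 *ℤ t in y *ℤ y *ℤ y ≡ y +ℤ + 3 *ℤ (+ 9 *ℤ t *ℤ t *ℤ t -ℤ t)
  expand = solve-∀
... | 1F , t , refl = _ , expand t
  where
  expand : ∀ t → let y = + 1 +ℤ + 3 *ℤ t in y *ℤ y *ℤ y ≡ y +ℤ + 3 *ℤ (+ 9 *ℤ t *ℤ t *ℤ t +ℤ + 9 *ℤ t *ℤ t +ℤ + 2 *ℤ t)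
  expand = solve-∀
... | 2F , t , refl = _ , expand t
  where
  expand : ∀ t → let y = + 2 +ℤ + 3 *ℤ t in
    y *ℤ y *ℤ y ≡ y +ℤ + 3 *ℤ (+ 9 *ℤ t *ℤ t *ℤ t +ℤ + 18 *ℤ t *ℤ t +ℤ + 11 *ℤ t +ℤ + 2)
  expand = solve-∀

-- Write f = c + q g; then f³ ≡ c³ + q³ g³ (mod 3).
cube-at : ∀ f n → ∃[ k ] (f ^ˢ 3) n ≡ V f n +ℤ + 3 *ℤ k
cube-at f n = step n
  where
  g = tail f
  c = const (f 0)
  error = c ^ˢ 2 ⊛ (X 1 ⊛ g) ⊕ c ⊛ (X 1 ⊛ g) ^ˢ 2
  split : ∀ n → (f ^ˢ 3) n ≡ const (f 0 *ℤ f 0 *ℤ f 0) n +ℤ shift (shift (shift (g ^ˢ 3))) n +ℤ + 3 *ℤ error n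
  split n = trans (at (≈-trans (^ˢ-congˡ 3 (head-tail f))
      (solve 3 (λ c x g → (c :+ x :* g) :^ 3 :=
                 c :* c :* c :+ x :* (x :* (x :* g :^ 3)) :+ con (+ 3) :* (c :^ 2 :* (x :* g) :+ c :* (x :* g) :^ 2))
             ≈-refl c (X 1) g)) n)
    (cong₂ _+ℤ_ (cong₂ _+ℤ_ (at (≈-trans (⊛-cong const-⊛-const ≈-refl) const-⊛-const) n) (at shifts n)) (const-⊛ (+ 3) error n))
    where
    const-⊛-const : ∀ {a b} → const a ⊛ const b ≈ const (a *ℤ b)
    const-⊛-const {a} = pointwise λ { zero → refl ; (suc n) → trans (const-⊛ a _ (suc n)) (ℤ.*-zeroʳ a) }
    shifts : X 1 ⊛ (X 1 ⊛ (X 1 ⊛ g ^ˢ 3)) ≈ shift (shift (shift (g ^ˢ 3)))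
    shifts = ≈-trans (X1-⊛ _) (shift-cong (≈-trans (X1-⊛ _) (shift-cong (X1-⊛ _))))
  step : ∀ n → ∃[ k ] (f ^ˢ 3) n ≡ V f n +ℤ + 3 *ℤ k
  step 0 with fermat3 (f 0)
  ... | k , eq = k +ℤ error 0 , trans (split 0)
      (trans (cong (λ y → y +ℤ 0ℤ +ℤ + 3 *ℤ error 0) eq) (collect (f 0) k (error 0)))
    where
    collect : ∀ a k e → a +ℤ + 3 *ℤ k +ℤ 0ℤ +ℤ + 3 *ℤ e ≡ a +ℤ + 3 *ℤ (k +ℤ e)
    collect = solve-∀
  step 1 = error 1 , split 1
  step 2 = error 2 , split 2
  step (suc (suc (suc m))) with cube-at (tail f) m
  ... | k , eq = k +ℤ error (3 + m) , trans (split (3 + m))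
      (trans (cong (λ y → 0ℤ +ℤ y +ℤ + 3 *ℤ error (3 + m)) eq) (collect (V g m) k (error (3 + m))))
    where
    collect : ∀ a k e → 0ℤ +ℤ (a +ℤ + 3 *ℤ k) +ℤ + 3 *ℤ e ≡ a +ℤ + 3 *ℤ (k +ℤ e)
    collect = solve-∀

-- Cubing lifts a congruence modulo 3 to one modulo 9: in (v + 3k)³ every term except v³ contains 9.
ninth-power : ∀ f → ∃[ h ] f ^ˢ 9 ≈ V f ^ˢ 3 ⊕ const (+ 9) ⊛ h
ninth-power f = _ , ≈-trans (solve 1 (λ f → f :^ 9 := (f :^ 3) :^ 3) ≈-refl f)
  (≈-trans (^ˢ-congˡ 3 cube)
    (solve 2 (λ v k → (v :+ con (+ 3) :* k) :^ 3 :=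
        v :^ 3 :+ con (+ 9) :* (v :^ 2 :* k :+ con (+ 3) :* v :* k :^ 2 :+ con (+ 3) :* k :^ 3)) ≈-refl (V f) k))
  where
  k : Series
  k n = proj₁ (cube-at f n)
  cube : f ^ˢ 3 ≈ V f ⊕ const (+ 3) ⊛ k
  cube = pointwise λ n → trans (proj₂ (cube-at f n)) (cong (V f n +ℤ_) (sym (const-⊛ (+ 3) k n)))

-- Gauss's identity, in finite form

≡⇒≈ : ∀ {f g} → f ≡ g → f ≈ g
≡⇒≈ refl = ≈-refl

-- Each coefficient of h is determined by strictly earlier ones, so all vanish; the bound k in
-- `upTo` provides course-of-values induction.
X-⊛-fixed⇒0 : ∀ n h → h ≈ X (suc n) ⊛ h → ∀ k → h k ≡ 0ℤ
X-⊛-fixed⇒0 n h fixed k = upTo k k ℕ.≤-refl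
  where
  upTo : ∀ k j → j ≤ k → h j ≡ 0ℤ
  upTo k       zero    _         = trans (at fixed 0) (X-⊛-< (suc n) h 0 (s≤s z≤n))
  upTo (suc k) (suc j) (s≤s j≤k) = trans (at fixed (suc j)) (trans (at (shift-⊛ (X n) h) (suc j))
    (trans (⊛-comm-at (X n) h j) (trans (⊛-cong-≤ {g = X n} j (λ i i≤j → upTo k i (ℕ.≤-trans i≤j j≤k)) (λ _ _ → refl))
       (0⊛ (λ _ → refl) (X n) j))))

-- This replaces division by 1 - q^(n+1): the difference f - g is fixed under multiplication by
-- q^(n+1).
1-X-cancel : ∀ n f g → (const 1ℤ ⊕ ⊖ X (suc n)) ⊛ f ≈ (const 1ℤ ⊕ ⊖ X (suc n)) ⊛ g → f ≈ g
1-X-cancel n f g eq = pointwise λ k → ℤ.i-j≡0⇒i≡j (f k) (g k) (X-⊛-fixed⇒0 n (f ⊕ ⊖ g) fixed k)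
  where
  x = X (suc n)
  fixed : f ⊕ ⊖ g ≈ x ⊛ (f ⊕ ⊖ g)
  fixed = ≈-trans
    (solve 3 (λ x f g → f :- g := (con 1ℤ :- x) :* f :+ x :* f :- g) ≈-refl x f g)
    (≈-trans (⊕-cong (⊕-cong eq ≈-refl) ≈-refl)
      (solve 3 (λ x f g → (con 1ℤ :- x) :* g :+ x :* f :- g := x :* (f :- g)) ≈-refl x f g))

-- The sign is a power of a constant series, so that `σ (suc s)` unfolds to a product with a
-- constant known to the ring solver.
σ : ℕ → Series
σ s = const -1ℤ ^ˢ s

-- The sum of (-1)ʲ q^(j²) over all integers j with ∣ j ∣ ≤ n.
F : ℕ → Series
F zero    = const 1ℤ
F (suc n) = F n ⊕ const (+ 2) ⊛ (σ (suc n) ⊛ X (suc n * suc n))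

-- In the application P s is the product of (1 + qᵏ)/(1 - qᵏ) over k ≤ s, and
-- T s = P s /(1 - q^(s+1)).  Following Shanks, P n · F n is rewritten as a sum
-- whose terms other than the first are divisible by q^(n+1).
module Gauss
  (P T : ℕ → Series)
  (P-zero : P 0 ≈ const 1ℤ)
  (T-eq   : ∀ s → T s ≈ P s ⊕ X (suc s) ⊛ T s)
  (P-suc  : ∀ s → P (suc s) ≈ P s ⊕ const (+ 2) ⊛ (X (suc s) ⊛ T s))
  where

  S : ℕ → ℕ → Series
  S n zero    = const 1ℤ
  S n (suc j) = S n j ⊕ const (+ 2) ⊛ (σ (suc j) ⊛ X (suc j * n) ⊛ T j)

  P-T : ∀ s → P s ≈ T s ⊕ ⊖ (X (suc s) ⊛ T s)
  P-T s = ≈-trans (solve 2 (λ p z → p := p :+ z :- z) ≈-refl (P s) (X (suc s) ⊛ T s))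
                  (⊕-cong (≈-sym (T-eq s)) ≈-refl)

  P-suc-T : ∀ s → P (suc s) ≈ T s ⊕ X (suc s) ⊛ T s
  P-suc-T s = ≈-trans (P-suc s) (≈-trans (⊕-cong (P-T s) ≈-refl)
    (solve 2 (λ t z → t :- z :* t :+ con (+ 2) :* (z :* t) := t :+ z :* t) ≈-refl (T s) (X (suc s))))

  X-*-suc : ∀ s n → X (s * suc n) ≈ X s ⊛ X (s * n)
  X-*-suc s n = ≈-trans (≡⇒≈ (cong X (ℕ.*-suc s n))) (X-+ s (s * n))

  -- Induction on j. Since P j = (1 - q^(j+1)) T j and P (j+1) = (1 + q^(j+1)) T j, the boundary
  -- term with P j, together with the new term of `S (suc n)`, turns into the new term of `S n` and
  -- the next boundary term.
  telescope : ∀ n j → (const 1ℤ ⊕ ⊖ X n) ⊛ S (suc n) j ≈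
    (const 1ℤ ⊕ X n) ⊛ S n j ⊕ const (+ 2) ⊛ (σ (suc j) ⊛ X (suc j * n) ⊛ P j)
  telescope n zero = ≈-trans
    (solve 1 (λ y → (con 1ℤ :- y) :* con 1ℤ :=
                (con 1ℤ :+ y) :* con 1ℤ :+ con (+ 2) :* ((con -1ℤ :^ 1) :* y :* con 1ℤ)) ≈-refl (X n))
    (⊕-congˡ ((const 1ℤ ⊕ X n) ⊛ const 1ℤ) (⊛-cong (≈-refl {const (+ 2)})
      (⊛-cong (⊛-cong (≈-refl {σ 1}) (≡⇒≈ (cong X (sym (ℕ.+-identityʳ n))))) (≈-sym P-zero))))
  telescope n (suc j) = begin
    (const 1ℤ ⊕ ⊖ y) ⊛ (S (suc n) j ⊕ const (+ 2) ⊛ (s ⊛ X (suc j * suc n) ⊛ t))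
      ≈⟨ ⊛-cong ≈-refl (⊕-congˡ (S (suc n) j) (⊛-cong ≈-refl (⊛-cong (⊛-cong ≈-refl (X-*-suc (suc j) n)) ≈-refl))) ⟩
    (const 1ℤ ⊕ ⊖ y) ⊛ (S (suc n) j ⊕ const (+ 2) ⊛ (s ⊛ (z ⊛ x) ⊛ t))
      ≈⟨ ⊛-distribˡ (const 1ℤ ⊕ ⊖ y) (S (suc n) j) (const (+ 2) ⊛ (s ⊛ (z ⊛ x) ⊛ t)) ⟩
    (const 1ℤ ⊕ ⊖ y) ⊛ S (suc n) j ⊕ (const 1ℤ ⊕ ⊖ y) ⊛ (const (+ 2) ⊛ (s ⊛ (z ⊛ x) ⊛ t))
      ≈⟨ ⊕-cong (≈-trans (telescope n j) (⊕-congˡ ((const 1ℤ ⊕ y) ⊛ S n j) (⊛-cong ≈-refl (⊛-cong ≈-refl (P-T j))))) ≈-refl ⟩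
    (const 1ℤ ⊕ y) ⊛ S n j ⊕ const (+ 2) ⊛ (s ⊛ x ⊛ (t ⊕ ⊖ (z ⊛ t)))
      ⊕ (const 1ℤ ⊕ ⊖ y) ⊛ (const (+ 2) ⊛ (s ⊛ (z ⊛ x) ⊛ t))
      ≈⟨ solve 6 (λ S s x y z t →
            (con 1ℤ :+ y) :* S :+ con (+ 2) :* (s :* x :* (t :- z :* t))
              :+ (con 1ℤ :- y) :* (con (+ 2) :* (s :* (z :* x) :* t)) :=
            (con 1ℤ :+ y) :* (S :+ con (+ 2) :* (s :* x :* t))
              :+ con (+ 2) :* (con -1ℤ :* s :* (y :* x) :* (t :+ z :* t)))
           ≈-refl (S n j) s x y z t ⟩
    (const 1ℤ ⊕ y) ⊛ (S n j ⊕ const (+ 2) ⊛ (s ⊛ x ⊛ t))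
      ⊕ const (+ 2) ⊛ (const -1ℤ ⊛ s ⊛ (y ⊛ x) ⊛ (t ⊕ z ⊛ t))
      ≈⟨ ⊕-congˡ ((const 1ℤ ⊕ y) ⊛ S n (suc j))
           (⊛-cong ≈-refl (⊛-cong (⊛-cong ≈-refl (≈-sym (X-+ n (suc j * n)))) (≈-sym (P-suc-T j)))) ⟩
    (const 1ℤ ⊕ y) ⊛ S n (suc j) ⊕ const (+ 2) ⊛ (σ (2 + j) ⊛ X ((2 + j) * n) ⊛ P (suc j)) ∎
    where
    open ≈-Reasoning
    s = σ (suc j)
    x = X (suc j * n)
    y = X n
    z = X (suc j)
    t = T j

  -- Multiplication by 1 - q^(n+1) turns P (n+1) into (1 + q^(n+1)) P n, so the induction hypothesis
  -- applies to the old part of F. The new square q^((n+1)²) splits in two: one half is the boundary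
  -- term that `telescope` needs in order to raise the first argument of S, the other is the last
  -- term of the longer sum.
  P-⊛-F : ∀ n → P n ⊛ F n ≈ S (suc n) n
  P-⊛-F zero    = ≈-trans (⊛-cong P-zero ≈-refl) (⊛-identityˡ (const 1ℤ))
  P-⊛-F (suc n) = 1-X-cancel n (P N ⊛ F N) (S (suc N) N) (begin
    (const 1ℤ ⊕ ⊖ y) ⊛ (P N ⊛ (F n ⊕ const (+ 2) ⊛ (s ⊛ x)))
      ≈⟨ ⊛-cong ≈-refl (⊛-cong (P-suc-T n) ≈-refl) ⟩
    (const 1ℤ ⊕ ⊖ y) ⊛ ((t ⊕ y ⊛ t) ⊛ (F n ⊕ const (+ 2) ⊛ (s ⊛ x)))
      ≈⟨ solve 5 (λ f s x y t →
           (con 1ℤ :- y) :* ((t :+ y :* t) :* (f :+ con (+ 2) :* (s :* x))) :=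
           (con 1ℤ :+ y) :* ((t :- y :* t) :* f) :+ con (+ 2) :* (s :* x :* (t :- y :* t))
             :+ (con 1ℤ :- y) :* (con (+ 2) :* (s :* (y :* x) :* t)))
           ≈-refl (F n) s x y t ⟩
    (const 1ℤ ⊕ y) ⊛ ((t ⊕ ⊖ (y ⊛ t)) ⊛ F n) ⊕ const (+ 2) ⊛ (s ⊛ x ⊛ (t ⊕ ⊖ (y ⊛ t)))
      ⊕ (const 1ℤ ⊕ ⊖ y) ⊛ (const (+ 2) ⊛ (s ⊛ (y ⊛ x) ⊛ t))
      ≈⟨ ⊕-cong (⊕-cong (⊛-cong ≈-refl (≈-trans (⊛-cong (≈-sym (P-T n)) ≈-refl) (P-⊛-F n)))
                        (⊛-cong ≈-refl (⊛-cong ≈-refl (≈-sym (P-T n)))))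
                (⊛-cong ≈-refl (⊛-cong ≈-refl (⊛-cong (⊛-cong ≈-refl (≈-sym (X-*-suc N N))) ≈-refl))) ⟩
    (const 1ℤ ⊕ y) ⊛ S N n ⊕ const (+ 2) ⊛ (s ⊛ x ⊛ P n)
      ⊕ (const 1ℤ ⊕ ⊖ y) ⊛ (const (+ 2) ⊛ (s ⊛ X (N * suc N) ⊛ t))
      ≈⟨ ⊕-cong (≈-sym (telescope N n)) ≈-refl ⟩
    (const 1ℤ ⊕ ⊖ y) ⊛ S (suc N) n ⊕ (const 1ℤ ⊕ ⊖ y) ⊛ (const (+ 2) ⊛ (s ⊛ X (N * suc N) ⊛ t))
      ≈⟨ ≈-sym (⊛-distribˡ (const 1ℤ ⊕ ⊖ y) (S (suc N) n) _) ⟩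
    (const 1ℤ ⊕ ⊖ y) ⊛ S (suc N) N ∎)
    where
    open ≈-Reasoning
    N = suc n
    s = σ N
    x = X (N * N)
    y = X N
    t = T n

  S-at : ∀ n j k → k < n → S n j k ≡ const 1ℤ k
  S-at n zero    k k<n = refl
  S-at n (suc j) k k<n = trans (cong₂ _+ℤ_ (S-at n j k k<n) (trans
      (at (≈-trans (⊛-cong ≈-refl (⊛-cong (⊛-cong ≈-refl (X-+ n (j * n))) ≈-refl))
        (solve 4 (λ s x y t → con (+ 2) :* (s :* (x :* y) :* t) := x :* (con (+ 2) :* s :* y :* t)) ≈-refl
          (σ (suc j)) (X n) (X (j * n)) (T j))) k)
      (X-⊛-< n (const (+ 2) ⊛ σ (suc j) ⊛ X (j * n) ⊛ T j) k k<n))) (ℤ.+-identityʳ _)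

  P-⊛-F-at : ∀ n → (P n ⊛ F n) n ≡ const 1ℤ n
  P-⊛-F-at n = trans (at (P-⊛-F n) n) (S-at (suc n) n n ℕ.≤-refl)

-- Counting and generating functions

open Enumeration using (elements; unique; size)

private variable
  A B : Set
  P Q : A → Set

∈⇒ : (e : Enumeration P) → ∀ {x} → x ∈ elements e → P x
∈⇒ e = Equivalence.to (Enumeration.∈⇔ e _)

⇒∈ : (e : Enumeration P) → ∀ {x} → P x → x ∈ elements e
⇒∈ e = Equivalence.from (Enumeration.∈⇔ e _)

-- Two duplicate-free lists with the same members are permutations of each other; here these are the
-- image under f and the second enumeration.
size-image : {P : A → Set} {Q : B → Set} (e : Enumeration P) (e′ : Enumeration Q) (f : A → B) →
  (∀ {x y} → f x ≡ f y → x ≡ y) → (∀ x → P x → Q (f x)) → (∀ y → Q y → ∃[ x ] P x × f x ≡ y) →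
  size e ≡ size e′
size-image e e′ f injective into onto = trans (sym (List.length-map f (elements e)))
  (↭-length (∼bag⇒↭ (unique∧set⇒bag (Unique.map⁺ injective (unique e)) (unique e′) (mk⇔ to from))))
  where
  to : ∀ {y} → y ∈ map f (elements e) → y ∈ elements e′
  to y∈ with ∈-map⁻ f y∈
  ... | x , x∈ , refl = ⇒∈ e′ (into x (∈⇒ e x∈))
  from : ∀ {y} → y ∈ elements e′ → y ∈ map f (elements e)
  from {y} y∈ with onto y (∈⇒ e′ y∈)
  ... | x , px , refl = ∈-map⁺ f (⇒∈ e px)

size-cong : (e : Enumeration P) (e′ : Enumeration Q) → (∀ x → P x → Q x) → (∀ x → Q x → P x) → size e ≡ size e′
size-cong e e′ to from = size-image e e′ id id to (λ x qx → x , from x qx , refl)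

size-empty : (e : Enumeration P) → (∀ x → ¬ P x) → size e ≡ 0
size-empty e empty with elements e in eq
... | []     = refl
... | x ∷ _  = ⊥-elim (empty x (∈⇒ e (subst (x ∈_) (sym eq) (here refl))))

union : Enumeration P → Enumeration Q → (∀ x → P x → ¬ Q x) → Enumeration (λ x → P x ⊎ Q x)
union e e′ disjoint = record
  { elements = elements e ++ elements e′
  ; unique   = Unique.++⁺ (unique e) (unique e′) (λ (x∈ , x∈′) → disjoint _ (∈⇒ e x∈) (∈⇒ e′ x∈′))
  ; ∈⇔       = λ x → mk⇔ (Sum.map (∈⇒ e) (∈⇒ e′) ∘ ∈-++⁻ (elements e))
                          [ ∈-++⁺ˡ ∘ ⇒∈ e , ∈-++⁺ʳ (elements e) ∘ ⇒∈ e′ ]′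
  }

size-union : (e : Enumeration P) (e′ : Enumeration Q) (disjoint : ∀ x → P x → ¬ Q x) →
  size (union e e′ disjoint) ≡ size e + size e′
size-union e e′ _ = List.length-++ (elements e)

product : {P : A → Set} {Q : B → Set} → Enumeration P → Enumeration Q → Enumeration (λ (a , b) → P a × Q b)
product e e′ = record
  { elements = cartesianProduct (elements e) (elements e′)
  ; unique   = Unique.cartesianProduct⁺ (unique e) (unique e′)
  ; ∈⇔       = λ _ → mk⇔ (λ xy∈ → let x∈ , y∈ = ∈-cartesianProduct⁻ (elements e) (elements e′) xy∈ in ∈⇒ e x∈ , ∈⇒ e′ y∈)
                          (λ (px , qy) → ∈-cartesianProduct⁺ (⇒∈ e px) (⇒∈ e′ qy))
  }

restrict : Decidable Q → Enumeration P → Enumeration (λ x → P x × Q x)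
restrict Q? e = record
  { elements = filter Q? (elements e)
  ; unique   = Unique.filter⁺ Q? (unique e)
  ; ∈⇔       = λ x → mk⇔ (map₁ (∈⇒ e) ∘ ∈-filter⁻ Q?) (λ (px , qx) → ∈-filter⁺ Q? (⇒∈ e px) qx)
  }

transport : (∀ x → P x → Q x) → (∀ x → Q x → P x) → Enumeration P → Enumeration Q
transport to from e = record
  { elements = elements e ; unique = unique e ; ∈⇔ = λ x → mk⇔ (to x ∘ ∈⇒ e) (⇒∈ e ∘ from x) }

image : {P : A → Set} (f : A → B) → (∀ {x y} → f x ≡ f y → x ≡ y) →
  Enumeration P → Enumeration (λ y → ∃[ x ] P x × f x ≡ y)
image f injective e = record
  { elements = map f (elements e)
  ; unique   = Unique.map⁺ injective (unique e)
  ; ∈⇔       = λ y → mk⇔ (λ y∈ → let x , x∈ , eq = ∈-map⁻ f y∈ in x , ∈⇒ e x∈ , sym eq)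
                          (λ { (x , px , refl) → ∈-map⁺ f (⇒∈ e px) })
  }

emptyEnumeration : Enumeration {A} (λ _ → ⊥)
emptyEnumeration = record
  { elements = [] ; unique = AllPairs.[] ; ∈⇔ = λ x → mk⇔ (λ ()) (λ ()) }

singleton : (x : A) → Enumeration (_≡ x)
singleton x = record
  { elements = x ∷ [] ; unique = All.[] AllPairs.∷ AllPairs.[]
  ; ∈⇔ = λ y → mk⇔ (λ { (here eq) → eq ; (there ()) }) here }

count : {P : ℕ → A → Set} → (∀ n → Enumeration (P n)) → Series
count e n = + size (e n)

-- Raises weights by s, the counting counterpart of multiplication by q^s. The recursion follows
-- `shift` and needs no subtraction.
Delay : ℕ → (ℕ → A → Set) → ℕ → A → Set
Delay zero    Q m       x = Q m x
Delay (suc s) Q zero    x = ⊥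
Delay (suc s) Q (suc m) x = Delay s Q m x

delay-intro : (Q : ℕ → A → Set) → ∀ s {k x} → Q k x → Delay s Q (s + k) x
delay-intro Q zero    q = q
delay-intro Q (suc s) q = delay-intro Q s q

delay-elim : (Q : ℕ → A → Set) → ∀ s m {x} → Delay s Q m x → ∃[ k ] s + k ≡ m × Q k x
delay-elim Q zero    m       q = m , refl , q
delay-elim Q (suc s) (suc m) q = let k , eq , q′ = delay-elim Q s m q in k , cong suc eq , q′

delay : {Q : ℕ → A → Set} → ∀ s → (∀ n → Enumeration (Q n)) → ∀ m → Enumeration (Delay s Q m)
delay zero    e m       = e m
delay (suc s) e zero    = emptyEnumeration
delay (suc s) e (suc m) = delay s e m

count-delay : {Q : ℕ → A → Set} → ∀ s (e : ∀ n → Enumeration (Q n)) m → count (delay s e) m ≡ (X s ⊛ count e) m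
count-delay zero    e m       = sym (at (⊛-identityˡ (count e)) m)
count-delay (suc s) e zero    = sym (at (shift-⊛ (X s) (count e)) 0)
count-delay (suc s) e (suc m) = trans (count-delay s e m) (sym (at (shift-⊛ (X s) (count e)) (suc m)))

-- The clauses copy those of `_⊛_`, so that `count-conv` can be proved clause by clause.
Conv : (ℕ → A → Set) → (ℕ → B → Set) → ℕ → A × B → Set
Conv P Q zero    (a , b) = P 0 a × Q 0 b
Conv P Q (suc n) (a , b) = (P 0 a × Q (suc n) b) ⊎ Conv (P ∘ suc) Q n (a , b)

conv-intro : ∀ (P : ℕ → A → Set) (Q : ℕ → B → Set) i {j a b} → P i a → Q j b → Conv P Q (i + j) (a , b)
conv-intro P Q zero {zero}  p q = p , q
conv-intro P Q zero {suc j} p q = inj₁ (p , q)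
conv-intro P Q (suc i)      p q = inj₂ (conv-intro (P ∘ suc) Q i p q)

conv-elim : ∀ (P : ℕ → A → Set) (Q : ℕ → B → Set) n {a b} → Conv P Q n (a , b) →
  ∃[ i ] ∃[ j ] i + j ≡ n × P i a × Q j b
conv-elim P Q zero    (p , q)        = 0 , 0 , refl , p , q
conv-elim P Q (suc n) (inj₁ (p , q)) = 0 , suc n , refl , p , q
conv-elim P Q (suc n) (inj₂ c) with conv-elim (P ∘ suc) Q n c
... | i , j , eq , p , q = suc i , j , cong suc eq , p , q

module _ {Q : ℕ → B → Set} (eQ : ∀ n → Enumeration (Q n)) where

  -- `graded` gives each first component a single weight; otherwise one pair could arise from
  -- several splittings of n and the union would not be disjoint.
  conv : {P : ℕ → A → Set} → (∀ n → Enumeration (P n)) → (∀ {i j a} → P i a → P j a → i ≡ j) →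
         ∀ n → Enumeration (Conv P Q n)
  conv eP graded zero    = product (eP 0) (eQ 0)
  conv {P = P} eP graded (suc n) = union (product (eP 0) (eQ (suc n)))
    (conv (eP ∘ suc) (λ p p′ → ℕ.suc-injective (graded p p′)) n)
    (λ { (a , b) (p , _) c → disjoint p (conv-elim (P ∘ suc) Q n c) })
    where
    disjoint : ∀ {a b} → P 0 a → ¬ (∃[ i ] ∃[ j ] i + j ≡ n × P (suc i) a × Q j b)
    disjoint p (_ , _ , _ , p′ , _) with () ← graded p p′

  size-product : {P : A → Set} (e : Enumeration P) → ∀ n → + size (product e (eQ n)) ≡ + size e *ℤ + size (eQ n)
  size-product e n = trans (cong +_ (length-cartesianProduct (elements e) (elements (eQ n))))
                           (ℤ.pos-* (size e) (size (eQ n)))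
    where
    length-cartesianProduct : ∀ {A B : Set} (xs : List A) (ys : List B) → length (cartesianProduct xs ys) ≡ length xs * length ys
    length-cartesianProduct []       ys = refl
    length-cartesianProduct (x ∷ xs) ys = trans (List.length-++ (map (x ,_) ys))
      (cong₂ _+_ (List.length-map (x ,_) ys) (length-cartesianProduct xs ys))

  count-conv : {P : ℕ → A → Set} (eP : ∀ n → Enumeration (P n)) (graded : ∀ {i j a} → P i a → P j a → i ≡ j) →
    ∀ n → count (conv eP graded) n ≡ (count eP ⊛ count eQ) n
  count-conv eP graded zero    = size-product (eP 0) 0
  count-conv eP graded (suc n) = trans (cong +_ (List.length-++ (elements (product (eP 0) (eQ (suc n))))))
    (cong₂ _+ℤ_ (size-product (eP 0) (suc n)) (count-conv (eP ∘ suc) _ n))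

-- Overpartitions

HeadAtMost : ℕ → List Part → Set
HeadAtMost s []            = ⊤
HeadAtMost s ((a , _) ∷ _) = a ≤ s

headAtMost? : ∀ s → Decidable (HeadAtMost s)
headAtMost? s []            = yes tt
headAtMost? s ((a , _) ∷ _) = a ≤? s

CanFollow : ℕ → List Part → Set
CanFollow s []      = ⊤
CanFollow s (p ∷ _) = (s , false) CanPrecede p

canFollow? : ∀ s → Decidable (CanFollow s)
canFollow? s []            = yes tt
canFollow? s ((b , o) ∷ _) = (b <? s) ⊎-dec ((b ≟ s) ×-dec (o Bool.≟ false))

Below : ℕ → ℕ → List Part → Set
Below s m ps = IsOverpartition m ps × HeadAtMost s ps

-- What may stand behind a part of size s + 1: parts up to s + 1, the copies of s + 1 itself not
-- overlined. Its generating function is the T s of the module `Gauss`.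
After : ℕ → ℕ → List Part → Set
After s m ps = IsOverpartition m ps × CanFollow (suc s) ps

below : ∀ s m → Enumeration (Below s m)
below s m = restrict (headAtMost? s) (overpartitions m)

after : ∀ s m → Enumeration (After s m)
after s m = restrict (canFollow? (suc s)) (overpartitions m)

overpartition-uncons : ∀ {m a o ps} → IsOverpartition m ((a , o) ∷ ps) →
  ∃[ k ] a + k ≡ m × IsOverpartition k ps × CanFollow a ps
overpartition-uncons {ps = []}    (_ All.∷ 0<ps , _ , eq) = _ , eq , (0<ps , Linked.[] , refl) , tt
overpartition-uncons {ps = _ ∷ _} (_ All.∷ 0<ps , r Linked.∷ rs , eq) = _ , eq , (0<ps , rs , refl) , r

overpartition-cons : ∀ {a k o ps} → 0 < a → IsOverpartition k ps → CanFollow a ps →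
  IsOverpartition (a + k) ((a , o) ∷ ps)
overpartition-cons {ps = []}    0<a (0<ps , rs , refl) r = 0<a All.∷ 0<ps , Linked.[-] , refl
overpartition-cons {ps = _ ∷ _} 0<a (0<ps , rs , refl) r = 0<a All.∷ 0<ps , r Linked.∷ rs , refl

StartsWith : Part → ℕ → List Part → Set
StartsWith (a , o) m ps = ∃[ ps′ ] Delay a (After (pred a)) m ps′ × (a , o) ∷ ps′ ≡ ps

startsWith : ∀ s o m → Enumeration (StartsWith (suc s , o) m)
startsWith s o m = image ((suc s , o) ∷_) List.∷-injectiveʳ (delay (suc s) (after s) m)

startsWith-to : ∀ s o {m ps} → StartsWith (suc s , o) m ps → ∃[ ps′ ] (suc s , o) ∷ ps′ ≡ ps × IsOverpartition m ps
startsWith-to s o {m} (ps′ , d , refl) with delay-elim (After s) (suc s) m d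
... | k , refl , op , follows = ps′ , refl , overpartition-cons (s≤s z≤n) op follows

startsWith-from : ∀ s o {m ps′} → IsOverpartition m ((suc s , o) ∷ ps′) → StartsWith (suc s , o) m ((suc s , o) ∷ ps′)
startsWith-from s o op with overpartition-uncons op
... | k , refl , op′ , follows = _ , delay-intro (After s) (suc s) (op′ , follows) , refl

count-startsWith : ∀ s o m → count (startsWith s o) m ≡ (X (suc s) ⊛ count (after s)) m
count-startsWith s o m = trans (cong +_ (List.length-map _ (elements (delay (suc s) (after s) m))))
                               (count-delay (suc s) (after s) m)

-- Either no part equals s + 1, or the first one is a plain s + 1; deleting it leaves a list of the
-- same kind.
after-eq : ∀ s → count (after s) ≈ count (below s) ⊕ X (suc s) ⊛ count (after s)
after-eq s = pointwise λ m → trans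
  (cong +_ (trans (size-cong (after s m) (union (below s m) (startsWith s false m) (disjoint m)) (to m) (from m))
                  (size-union (below s m) (startsWith s false m) (disjoint m))))
  (cong (+ size (below s m) +ℤ_) (count-startsWith s false m))
  where
  disjoint : ∀ m ps → Below s m ps → ¬ StartsWith (suc s , false) m ps
  disjoint m ps (_ , ≤s) (_ , _ , refl) = ℕ.<-irrefl refl ≤s
  to : ∀ m ps → After s m ps → Below s m ps ⊎ StartsWith (suc s , false) m ps
  to m []       (op , _) = inj₁ (op , tt)
  to m (_ ∷ _)  (op , inj₁ (s≤s a≤s))      = inj₁ (op , a≤s)
  to m (_ ∷ ps) (op , inj₂ (refl , refl)) = inj₂ (startsWith-from s false op)
  from : ∀ m ps → Below s m ps ⊎ StartsWith (suc s , false) m ps → After s m ps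
  from m []      (inj₁ (op , _))   = op , tt
  from m (_ ∷ _) (inj₁ (op , a≤s)) = op , inj₁ (s≤s a≤s)
  from m ps      (inj₂ w) with startsWith-to s false {m} w
  ... | _ , refl , op = op , inj₂ (refl , refl)

-- The factor 2 is the choice of overlining the first part of size s + 1; the rest of the list is
-- counted by `after s` in both cases.
below-suc : ∀ s → count (below (suc s)) ≈ count (below s) ⊕ const (+ 2) ⊛ (X (suc s) ⊛ count (after s))
below-suc s = pointwise λ m → trans
  (cong +_ (trans (size-cong (below (suc s) m) (union (below s m) (both m) (disjoint m)) (to m) (from m))
    (trans (size-union (below s m) (both m) (disjoint m))
       (cong (λ k → size (below s m) + k) (size-union (startsWith s true m) (startsWith s false m) (disjoint′ m))))))
  (cong (+ size (below s m) +ℤ_) (trans (cong₂ _+ℤ_ (count-startsWith s true m) (count-startsWith s false m))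
     (at (solve 1 (λ x → x :+ x := con (+ 2) :* x) ≈-refl (X (suc s) ⊛ count (after s))) m)))
  where
  Starts : ℕ → List Part → Set
  Starts m ps = StartsWith (suc s , true) m ps ⊎ StartsWith (suc s , false) m ps
  disjoint′ : ∀ m ps → StartsWith (suc s , true) m ps → ¬ StartsWith (suc s , false) m ps
  disjoint′ m ps (_ , _ , refl) (_ , _ , ())
  both : ∀ m → Enumeration (Starts m)
  both m = union (startsWith s true m) (startsWith s false m) (disjoint′ m)
  disjoint : ∀ m ps → Below s m ps → ¬ Starts m ps
  disjoint m ps (_ , ≤s) (inj₁ (_ , _ , refl)) = ℕ.<-irrefl refl ≤s
  disjoint m ps (_ , ≤s) (inj₂ (_ , _ , refl)) = ℕ.<-irrefl refl ≤s
  to : ∀ m ps → Below (suc s) m ps → Below s m ps ⊎ Starts m ps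
  to m []             (op , _) = inj₁ (op , tt)
  to m ((a , o) ∷ ps) (op , a≤) with ℕ.m≤n⇒m<n∨m≡n a≤
  ... | inj₁ (s≤s a≤s) = inj₁ (op , a≤s)
  to m ((a , true)  ∷ ps) (op , a≤) | inj₂ refl = inj₂ (inj₁ (startsWith-from s true op))
  to m ((a , false) ∷ ps) (op , a≤) | inj₂ refl = inj₂ (inj₂ (startsWith-from s false op))
  from : ∀ m ps → Below s m ps ⊎ Starts m ps → Below (suc s) m ps
  from m []      (inj₁ (op , _))   = op , tt
  from m (_ ∷ _) (inj₁ (op , a≤s)) = op , ℕ.m≤n⇒m≤1+n a≤s
  from m ps (inj₂ (inj₁ w)) with startsWith-to s true {m} w
  ... | _ , refl , op = op , ℕ.≤-refl
  from m ps (inj₂ (inj₂ w)) with startsWith-to s false {m} w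
  ... | _ , refl , op = op , ℕ.≤-refl

below-zero : count (below 0) ≈ const 1ℤ
below-zero = pointwise λ
  { zero    → cong +_ (size-cong (below 0 0) (singleton []) to from)
  ; (suc m) → cong +_ (size-empty (below 0 (suc m)) empty) }
  where
  to : ∀ ps → Below 0 0 ps → ps ≡ []
  to []      _ = refl
  to (_ ∷ _) ((0<a All.∷ _ , _) , a≤0) = ⊥-elim (ℕ.<⇒≱ 0<a a≤0)
  from : ∀ ps → ps ≡ [] → Below 0 0 ps
  from _ refl = (All.[] , Linked.[] , refl) , tt
  empty : ∀ {m} ps → ¬ Below 0 (suc m) ps
  empty []      ((_ , _ , ()) , _)
  empty (_ ∷ _) ((0<a All.∷ _ , _) , a≤0) = ℕ.<⇒≱ 0<a a≤0

below-≥ : ∀ n m → m ≤ n → size (below n m) ≡ p̄ m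
below-≥ n m m≤n = size-cong (below n m) (overpartitions m) (λ _ → proj₁) λ ps op → op , bound ps op
  where
  bound : ∀ ps → IsOverpartition m ps → HeadAtMost n ps
  bound []            _              = tt
  bound ((a , _) ∷ _) (_ , _ , refl) = ℕ.≤-trans (ℕ.m≤m+n a _) m≤n

p̄-⊛-F-at : ∀ n → ((λ m → + p̄ m) ⊛ F n) n ≡ const 1ℤ n
p̄-⊛-F-at n = trans
  (⊛-cong-≤ {g = F n} n (λ m m≤n → cong +_ (sym (below-≥ n m m≤n))) (λ _ _ → refl))
  (Gauss.P-⊛-F-at (count ∘ below) (count ∘ after) below-zero after-eq below-suc n)

-- The theta series and the substitution q ↦ -q

IsRoot : ℕ → ℤ → Set
IsRoot n x = ∣ x ∣ * ∣ x ∣ ≡ n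

m≤m*m : ∀ m → m ≤ m * m
m≤m*m zero    = z≤n
m≤m*m (suc m) = ℕ.m≤m*n (suc m) (suc m)

roots : ∀ n → Enumeration (IsRoot n)
roots n = filterEnumeration (λ x → ∣ x ∣ * ∣ x ∣ ≟ n) (interval n) (interval-unique n)
  (λ x eq → interval-complete n x (ℕ.≤-trans (m≤m*m ∣ x ∣) (ℕ.≤-reflexive eq)))

φ : Series
φ = count roots

smallRoots : ∀ N n → Enumeration (λ x → IsRoot n x × ∣ x ∣ ≤ N)
smallRoots N n = restrict (λ x → ∣ x ∣ ≤? N) (roots n)

φ≤ : ℕ → Series
φ≤ N = count (smallRoots N)

φ≤-φ : ∀ N n → n ≤ N → φ≤ N n ≡ φ n
φ≤-φ N n n≤N = cong +_ (size-cong (smallRoots N n) (roots n) (λ _ → proj₁)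
  (λ x eq → eq , ℕ.≤-trans (m≤m*m ∣ x ∣) (ℕ.≤-trans (ℕ.≤-reflexive eq) n≤N)))

-- A single integer of weight 0. Delayed by (N+1)², two of these bring the roots ±(N+1) into the
-- truncated theta series.
Point : ℤ → ℕ → ℤ → Set
Point v zero    x = x ≡ v
Point v (suc n) x = ⊥

point : ∀ v n → Enumeration (Point v n)
point v zero    = singleton v
point v (suc n) = emptyEnumeration

count-point : ∀ v k n → count (delay k (point v)) n ≡ X k n
count-point v k n = trans (count-delay k (point v) n)
  (at (≈-trans (⊛-comm (X k) (count (point v))) (≈-trans (⊛-cong {g = X k} point-1 ≈-refl) (⊛-identityˡ (X k)))) n)
  where
  point-1 : count (point v) ≈ const 1ℤ
  point-1 = pointwise λ { zero → refl ; (suc n) → refl }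

delayed-point : ∀ v k n {x} → Delay k (Point v) n x → k ≡ n × x ≡ v
delayed-point v k n d with delay-elim (Point v) k n d
... | zero , refl , eq = sym (ℕ.+-identityʳ k) , eq

point-delayed : ∀ v k → Delay k (Point v) k v
point-delayed v k = subst (λ n → Delay k (Point v) n v) (ℕ.+-identityʳ k) (delay-intro (Point v) k {0} refl)

φ≤-suc : ∀ N → φ≤ (suc N) ≈ φ≤ N ⊕ const (+ 2) ⊛ X (suc N * suc N)
φ≤-suc N = pointwise λ n → trans
  (cong +_ (trans (size-cong (smallRoots (suc N) n) (union (smallRoots N n) (both n) (disjoint n)) (to n) (from n))
    (trans (size-union (smallRoots N n) (both n) (disjoint n))
      (cong (λ k → size (smallRoots N n) + k) (size-union (delay k (point v) n) (delay k (point v′) n) (disjoint′ n))))))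
  (cong (φ≤ N n +ℤ_) (trans (cong₂ _+ℤ_ (count-point v k n) (count-point v′ k n))
     (at (solve 1 (λ x → x :+ x := con (+ 2) :* x) ≈-refl (X k)) n)))
  where
  k = suc N * suc N
  v = + suc N
  v′ = -[1+ N ]
  Ends : ℕ → ℤ → Set
  Ends n x = Delay k (Point v) n x ⊎ Delay k (Point v′) n x
  disjoint′ : ∀ n x → Delay k (Point v) n x → ¬ Delay k (Point v′) n x
  disjoint′ n x d d′ with () ← trans (sym (proj₂ (delayed-point v k n d))) (proj₂ (delayed-point v′ k n d′))
  both : ∀ n → Enumeration (Ends n)
  both n = union (delay k (point v) n) (delay k (point v′) n) (disjoint′ n)
  ends : ∀ n x → Ends n x → k ≡ n × (x ≡ v ⊎ x ≡ v′)
  ends n x = [ map₂ inj₁ ∘ delayed-point v k n , map₂ inj₂ ∘ delayed-point v′ k n ]′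
  disjoint : ∀ n x → IsRoot n x × ∣ x ∣ ≤ N → ¬ Ends n x
  disjoint n x (_ , ≤N) d with ends n x d
  ... | _ , inj₁ refl = ℕ.<-irrefl refl ≤N
  ... | _ , inj₂ refl = ℕ.<-irrefl refl ≤N
  to : ∀ n x → IsRoot n x × ∣ x ∣ ≤ suc N → (IsRoot n x × ∣ x ∣ ≤ N) ⊎ Ends n x
  to n x (eq , ≤sN) with ℕ.m≤n⇒m<n∨m≡n ≤sN
  ... | inj₁ (s≤s ≤N) = inj₁ (eq , ≤N)
  to n (+ _)      (refl , _) | inj₂ refl = inj₂ (inj₁ (point-delayed v k))
  to n (-[1+ _ ]) (refl , _) | inj₂ refl = inj₂ (inj₂ (point-delayed v′ k))
  from : ∀ n x → (IsRoot n x × ∣ x ∣ ≤ N) ⊎ Ends n x → IsRoot n x × ∣ x ∣ ≤ suc N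
  from n x (inj₁ (eq , ≤N)) = eq , ℕ.m≤n⇒m≤1+n ≤N
  from n x (inj₂ d) with ends n x d
  ... | eq , inj₁ refl = eq , ℕ.≤-refl
  ... | eq , inj₂ refl = eq , ℕ.≤-refl

φ≤-zero : φ≤ 0 ≈ const 1ℤ
φ≤-zero = pointwise λ
  { zero    → cong +_ (size-cong (smallRoots 0 0) (singleton 0ℤ)
      (λ { (+ 0) _ → refl ; (+ suc _) (() , _) ; -[1+ _ ] (() , _) }) (λ { _ refl → refl , z≤n }))
  ; (suc n) → cong +_ (size-empty (smallRoots 0 (suc n))
      (λ { (+ 0) (() , _) ; (+ suc _) (_ , ()) ; -[1+ _ ] (_ , ()) })) }

-- The substitution q ↦ -q.
ε : Series → Series
ε f n = -1ℤ ^ℤ n *ℤ f n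

ε-involutive : ∀ f n → ε (ε f) n ≡ f n
ε-involutive f n = trans (sym (ℤ.*-assoc (-1ℤ ^ℤ n) (-1ℤ ^ℤ n) (f n)))
  (trans (cong (_*ℤ f n) (square n)) (ℤ.*-identityˡ (f n)))
  where
  square : ∀ n → -1ℤ ^ℤ n *ℤ -1ℤ ^ℤ n ≡ 1ℤ
  square zero    = refl
  square (suc n) = trans (signs (-1ℤ ^ℤ n)) (square n)
    where
    signs : ∀ a → -1ℤ *ℤ a *ℤ (-1ℤ *ℤ a) ≡ a *ℤ a
    signs = solve-∀

ε-⊛-at : ∀ f g n → ε (f ⊛ g) n ≡ (ε f ⊛ ε g) n
ε-⊛-at f g zero    = expand (f 0) (g 0)
  where
  expand : ∀ a b → 1ℤ *ℤ (a *ℤ b) ≡ (1ℤ *ℤ a) *ℤ (1ℤ *ℤ b)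
  expand = solve-∀
ε-⊛-at f g (suc n) = begin
  -1ℤ *ℤ s *ℤ (f 0 *ℤ g (suc n) +ℤ (tail f ⊛ g) n)
    ≡⟨ expand s (f 0) (g (suc n)) ((tail f ⊛ g) n) ⟩
  1ℤ *ℤ f 0 *ℤ (-1ℤ *ℤ s *ℤ g (suc n)) +ℤ -1ℤ *ℤ ε (tail f ⊛ g) n
    ≡⟨ cong (λ y → 1ℤ *ℤ f 0 *ℤ (-1ℤ *ℤ s *ℤ g (suc n)) +ℤ -1ℤ *ℤ y) (ε-⊛-at (tail f) g n) ⟩
  1ℤ *ℤ f 0 *ℤ (-1ℤ *ℤ s *ℤ g (suc n)) +ℤ -1ℤ *ℤ (ε (tail f) ⊛ ε g) n
    ≡⟨ cong (1ℤ *ℤ f 0 *ℤ (-1ℤ *ℤ s *ℤ g (suc n)) +ℤ_) (sym (scale-⊛ -1ℤ (ε (tail f)) (ε g) n)) ⟩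
  1ℤ *ℤ f 0 *ℤ (-1ℤ *ℤ s *ℤ g (suc n)) +ℤ (scale -1ℤ (ε (tail f)) ⊛ ε g) n
    ≡⟨ cong (1ℤ *ℤ f 0 *ℤ (-1ℤ *ℤ s *ℤ g (suc n)) +ℤ_)
         (⊛-cong-≤ {g = ε g} n (λ k _ → sym (ℤ.*-assoc -1ℤ (-1ℤ ^ℤ k) (f (suc k)))) (λ _ _ → refl)) ⟩
  (ε f ⊛ ε g) (suc n) ∎
  where
  open ≡-Reasoning
  s = -1ℤ ^ℤ n
  expand : ∀ s a b c → -1ℤ *ℤ s *ℤ (a *ℤ b +ℤ c) ≡ 1ℤ *ℤ a *ℤ (-1ℤ *ℤ s *ℤ b) +ℤ -1ℤ *ℤ (s *ℤ c)
  expand = solve-∀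

ε-const : ∀ c → ε (const c) ≈ const c
ε-const c = pointwise λ { zero → ℤ.*-identityˡ c ; (suc n) → ℤ.*-zeroʳ (-1ℤ ^ℤ suc n) }

ε-X : ∀ k → ε (X k) ≈ σ k ⊛ X k
ε-X zero    = ≈-trans (ε-const 1ℤ) (≈-sym (⊛-identityˡ (const 1ℤ)))
ε-X (suc k) = begin
  ε (shift (X k))                     ≈⟨ ε-shift (X k) ⟩
  const -1ℤ ⊛ shift (ε (X k))         ≈⟨ ⊛-cong ≈-refl (≈-trans (shift-cong (ε-X k)) (≈-sym (X1-⊛ (σ k ⊛ X k)))) ⟩
  const -1ℤ ⊛ (X 1 ⊛ (σ k ⊛ X k))     ≈⟨ solve 3 (λ x s y →
    con -1ℤ :* (x :* (s :* y)) := con -1ℤ :* s :* (x :* y)) ≈-refl (X 1) (σ k) (X k) ⟩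
  const -1ℤ ⊛ σ k ⊛ (X 1 ⊛ X k)       ≈⟨ ⊛-cong ≈-refl (X1-⊛ (X k)) ⟩
  σ (suc k) ⊛ X (suc k) ∎
  where
  open ≈-Reasoning
  ε-shift : ∀ f → ε (shift f) ≈ const -1ℤ ⊛ shift (ε f)
  ε-shift f = pointwise λ
    { zero → refl
    ; (suc n) → trans (ℤ.*-assoc -1ℤ (-1ℤ ^ℤ n) (f n)) (sym (const-⊛ -1ℤ (shift (ε f)) (suc n))) }

-- A number and its square have the same parity; this is why q ↦ -q turns the theta series into the
-- alternating sum F.
σ-square : ∀ n → σ (n * n) ≈ σ n
σ-square zero    = ≈-refl
σ-square (suc n) = ⊛-cong ≈-refl (begin
  σ (n + n * suc n)            ≈⟨ ≡⇒≈ (cong (λ k → σ (n + k)) (ℕ.*-suc n n)) ⟩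
  σ (n + (n + n * n))          ≈⟨ ≈-trans (^-homo-* (const -1ℤ) n (n + n * n))
    (⊛-cong (≈-refl {σ n}) (^-homo-* (const -1ℤ) n (n * n))) ⟩
  σ n ⊛ (σ n ⊛ σ (n * n))      ≈⟨ ≈-sym (⊛-assoc (σ n) (σ n) (σ (n * n))) ⟩
  σ n ⊛ σ n ⊛ σ (n * n)        ≈⟨ ⊛-cong (σ² n) (σ-square n) ⟩
  const 1ℤ ⊛ σ n               ≈⟨ ⊛-identityˡ (σ n) ⟩
  σ n ∎)
  where
  open ≈-Reasoning
  σ² : ∀ n → σ n ⊛ σ n ≈ const 1ℤ
  σ² zero    = ⊛-identityˡ (const 1ℤ)
  σ² (suc n) = ≈-trans (solve 1 (λ s → con -1ℤ :* s :* (con -1ℤ :* s) := s :* s) ≈-refl (σ n)) (σ² n)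

F-φ≤ : ∀ N → F N ≈ ε (φ≤ N)
F-φ≤ zero    = ≈-sym (≈-trans (pointwise λ n → cong (-1ℤ ^ℤ n *ℤ_) (at φ≤-zero n)) (ε-const 1ℤ))
F-φ≤ (suc N) = pointwise λ n → trans
  (cong₂ _+ℤ_ (at (F-φ≤ N) n) (trans (const-⊛ (+ 2) (σ (suc N) ⊛ X k) n)
     (cong (+ 2 *ℤ_) (sym (at (≈-trans (ε-X k) (⊛-cong (σ-square (suc N)) ≈-refl)) n)))))
  (trans (collect (-1ℤ ^ℤ n) (φ≤ N n) (X k n))
    (cong (-1ℤ ^ℤ n *ℤ_) (sym (trans (at (φ≤-suc N) n) (cong (φ≤ N n +ℤ_) (const-⊛ (+ 2) (X k) n))))))
  where
  k = suc N * suc N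
  collect : ∀ s a x → s *ℤ a +ℤ + 2 *ℤ (s *ℤ x) ≡ s *ℤ (a +ℤ + 2 *ℤ x)
  collect = solve-∀

p̄-series : Series
p̄-series n = + p̄ n

εp̄-⊛-φ : ε p̄-series ⊛ φ ≈ const 1ℤ
εp̄-⊛-φ = pointwise λ n → begin
  -- The truncation point is the degree n itself. Inserting ε twice lets ε be pulled out of the
  -- whole product, which exposes `F n` as `ε (φ≤ n)`.
  (ε p̄-series ⊛ φ) n              ≡⟨ ⊛-cong-≤ {f = ε p̄-series} n (λ _ _ → refl)
                                      (λ k k≤n → sym (trans (ε-involutive (φ≤ n) k) (φ≤-φ n k k≤n))) ⟩
  (ε p̄-series ⊛ ε (ε (φ≤ n))) n   ≡⟨ ε-⊛-at p̄-series (ε (φ≤ n)) n ⟨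
  ε (p̄-series ⊛ ε (φ≤ n)) n       ≡⟨ cong (-1ℤ ^ℤ n *ℤ_) (at (⊛-cong (≈-refl {p̄-series}) (≈-sym (F-φ≤ n))) n) ⟩
  ε (p̄-series ⊛ F n) n            ≡⟨ cong (-1ℤ ^ℤ n *ℤ_) (p̄-⊛-F-at n) ⟩
  ε (const 1ℤ) n                  ≡⟨ at (ε-const 1ℤ) n ⟩
  const 1ℤ n ∎
  where open ≡-Reasoning

-- Residues modulo 3 and the tetracode

ι : Fin 3 → ℤ
ι c = + toℕ c

res : ℤ → Fin 3
res x = proj₁ (mod3 x)

res-quotient : ∀ x → ∃[ t ] x ≡ ι (res x) +ℤ + 3 *ℤ t
res-quotient x = proj₂ (mod3 x)

res-unique : ∀ {x} c t → x ≡ ι c +ℤ + 3 *ℤ t → res x ≡ c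
res-unique {x} c t eq = distinct (res x) c (Signed.divides (t -ℤ t′)
  (trans (difference (ι (res x)) (+ 3 *ℤ t′) (ι c)) (trans (cong (_-ℤ (ι c +ℤ + 3 *ℤ t′)) (trans (sym eq′) eq)) (factor (ι c) t t′))))
  where
  t′ = proj₁ (res-quotient x)
  eq′ : x ≡ ι (res x) +ℤ + 3 *ℤ t′
  eq′ = proj₂ (res-quotient x)
  difference : ∀ a b c → a -ℤ c ≡ (a +ℤ b) -ℤ (c +ℤ b)
  difference = solve-∀
  factor : ∀ c t t′ → c +ℤ + 3 *ℤ t -ℤ (c +ℤ + 3 *ℤ t′) ≡ (t -ℤ t′) *ℤ + 3
  factor = solve-∀
  distinct : ∀ a c → + 3 Signed.∣ ι a -ℤ ι c → a ≡ c
  distinct 0F 0F d = refl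
  distinct 1F 1F d = refl
  distinct 2F 2F d = refl
  distinct 0F 1F d = ⊥-elim (from-no (+ 3 Signed.∣? -1ℤ) d)
  distinct 0F 2F d = ⊥-elim (from-no (+ 3 Signed.∣? -[1+ 1 ]) d)
  distinct 1F 0F d = ⊥-elim (from-no (+ 3 Signed.∣? + 1) d)
  distinct 1F 2F d = ⊥-elim (from-no (+ 3 Signed.∣? -1ℤ) d)
  distinct 2F 0F d = ⊥-elim (from-no (+ 3 Signed.∣? + 2) d)
  distinct 2F 1F d = ⊥-elim (from-no (+ 3 Signed.∣? + 1) d)

res-+3* : ∀ x k → res (x +ℤ + 3 *ℤ k) ≡ res x
res-+3* x k with res-quotient x
... | t , eq = res-unique (res x) (t +ℤ k) (trans (cong (_+ℤ + 3 *ℤ k) eq) (collect (ι (res x)) t k))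
  where
  collect : ∀ c t k → c +ℤ + 3 *ℤ t +ℤ + 3 *ℤ k ≡ c +ℤ + 3 *ℤ (t +ℤ k)
  collect = solve-∀

res-≡⇒ : ∀ x y → res x ≡ res y → ∃[ k ] x ≡ y +ℤ + 3 *ℤ k
res-≡⇒ x y eq with res-quotient x | res-quotient y
... | t , p | t′ , p′ = t -ℤ t′ , trans p (trans (cong (λ c → ι c +ℤ + 3 *ℤ t) eq)
        (trans (rearrange (ι (res y)) t t′) (cong (_+ℤ + 3 *ℤ (t -ℤ t′)) (sym p′))))
  where
  rearrange : ∀ c t t′ → c +ℤ + 3 *ℤ t ≡ c +ℤ + 3 *ℤ t′ +ℤ + 3 *ℤ (t -ℤ t′)
  rearrange = solve-∀

res-cong : ∀ x y k → x ≡ y +ℤ + 3 *ℤ k → res x ≡ res y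
res-cong x y k eq = trans (cong res eq) (res-+3* y k)

res-plus : ∀ x y → res (x +ℤ y) ≡ res (ι (res x) +ℤ ι (res y))
res-plus x y = let t , eq = res-quotient x ; t′ , eq′ = res-quotient y in
  res-cong (x +ℤ y) (ι (res x) +ℤ ι (res y)) (t +ℤ t′) (trans (cong₂ _+ℤ_ eq eq′) (expand (ι (res x)) (ι (res y)) t t′))
  where
  expand : ∀ a b t t′ → a +ℤ + 3 *ℤ t +ℤ (b +ℤ + 3 *ℤ t′) ≡ a +ℤ b +ℤ + 3 *ℤ (t +ℤ t′)
  expand = solve-∀

res-minus : ∀ x y → res (x -ℤ y) ≡ res (ι (res x) -ℤ ι (res y))
res-minus x y = let t , eq = res-quotient x ; t′ , eq′ = res-quotient y in
  res-cong (x -ℤ y) (ι (res x) -ℤ ι (res y)) (t -ℤ t′) (trans (cong₂ _-ℤ_ eq eq′) (expand (ι (res x)) (ι (res y)) t t′))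
  where
  expand : ∀ a b t t′ → a +ℤ + 3 *ℤ t -ℤ (b +ℤ + 3 *ℤ t′) ≡ a -ℤ b +ℤ + 3 *ℤ (t -ℤ t′)
  expand = solve-∀

res-neg : ∀ x → res (-ℤ x) ≡ res (-ℤ ι (res x))
res-neg x = let t , eq = res-quotient x in
  res-cong (-ℤ x) (-ℤ ι (res x)) (-ℤ t) (trans (cong -ℤ_ eq) (expand (ι (res x)) t))
  where
  expand : ∀ a t → -ℤ (a +ℤ + 3 *ℤ t) ≡ -ℤ a +ℤ + 3 *ℤ -ℤ t
  expand = solve-∀

res-square : ∀ x → res (x *ℤ x) ≡ res (ι (res x) *ℤ ι (res x))
res-square x = let t , eq = res-quotient x in
  res-cong (x *ℤ x) (ι (res x) *ℤ ι (res x)) (t *ℤ (+ 2 *ℤ ι (res x) +ℤ + 3 *ℤ t))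
    (trans (cong (λ y → y *ℤ y) eq) (expand (ι (res x)) t))
  where
  expand : ∀ a t → (a +ℤ + 3 *ℤ t) *ℤ (a +ℤ + 3 *ℤ t) ≡ a *ℤ a +ℤ + 3 *ℤ (t *ℤ (+ 2 *ℤ a +ℤ + 3 *ℤ t))
  expand = solve-∀

res-pos : ∀ j m → res (+ (j + m * 3)) ≡ res (+ j)
res-pos j m = res-cong (+ (j + m * 3)) (+ j) (+ m) (cong (+ j +ℤ_) (trans (cong +_ (ℕ.*-comm m 3)) (ℤ.pos-* 3 m)))

-- Theta series of the residue classes modulo 3

class : ∀ c n → Enumeration (λ x → IsRoot n x × res x ≡ c)
class c n = restrict (λ x → res x Fin.≟ c) (roots n)

θ : Fin 3 → Series
θ c = count (class c)

size-by-residue : ∀ {A : Set} {P : A → Set} (e : Enumeration P) (κ : A → Fin 3)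
  (eᶜ : ∀ c → Enumeration (λ x → P x × κ x ≡ c)) → size e ≡ size (eᶜ 0F) + (size (eᶜ 1F) + size (eᶜ 2F))
size-by-residue {P = P} e κ eᶜ = trans
  (size-cong e (union (eᶜ 0F) (union (eᶜ 1F) (eᶜ 2F) (disjoint 1F 2F λ ()))
      (λ { x p (inj₁ q) → disjoint 0F 1F (λ ()) x p q ; x p (inj₂ q) → disjoint 0F 2F (λ ()) x p q }))
    (λ x p → split x p (κ x) refl) (λ x → [ proj₁ , [ proj₁ , proj₁ ]′ ]′))
  (trans (List.length-++ (elements (eᶜ 0F))) (cong (λ k → size (eᶜ 0F) + k) (List.length-++ (elements (eᶜ 1F)))))
  where
  disjoint : ∀ c d → c ≢ d → ∀ x → P x × κ x ≡ c → ¬ (P x × κ x ≡ d)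
  disjoint c d c≢d x (_ , eq) (_ , eq′) = c≢d (trans (sym eq) eq′)
  split : ∀ x → P x → ∀ c → κ x ≡ c → (P x × κ x ≡ 0F) ⊎ (P x × κ x ≡ 1F) ⊎ (P x × κ x ≡ 2F)
  split x p 0F eq = inj₁ (p , eq)
  split x p 1F eq = inj₂ (inj₁ (p , eq))
  split x p 2F eq = inj₂ (inj₂ (p , eq))

-- Negation preserves squares and exchanges the two nonzero residues.
θ₂≈θ₁ : θ 2F ≈ θ 1F
θ₂≈θ₁ = pointwise λ n → cong +_ (size-image (class 2F n) (class 1F n) -ℤ_ ℤ.neg-injective
  (λ x → flip n x 2F) (λ x p → -ℤ x , flip n x 1F p , ℤ.neg-involutive x))
  where
  flip : ∀ n x c → IsRoot n x × res x ≡ c → IsRoot n (-ℤ x) × res (-ℤ x) ≡ res (-ℤ ι c)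
  flip n x c (eq , refl) = trans (cong (λ a → a * a) (ℤ.∣-i∣≡∣i∣ x)) eq , res-neg x

φ-split : φ ≈ θ 0F ⊕ const (+ 2) ⊛ θ 1F
φ-split = ≈-trans (pointwise λ n → cong +_ (size-by-residue (roots n) res (λ c → class c n)))
  (≈-trans (⊕-congˡ (θ 0F) (⊕-congˡ (θ 1F) θ₂≈θ₁))
    (solve 2 (λ a b → a :+ (b :+ b) := a :+ con (+ 2) :* b) ≈-refl (θ 0F) (θ 1F)))

-- The square of an integer with residue c is congruent to c² modulo 3, which excludes all other
-- exponents.
θ-vanishes : ∀ c j m → res (ι c *ℤ ι c) ≢ res (+ j) → θ c (j + m * 3) ≡ 0ℤ
θ-vanishes c j m ≢ = cong +_ (size-empty (class c (j + m * 3)) λ { x (root , refl) →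
  ≢ (trans (sym (res-square x)) (trans (cong res (trans (square-abs x) (cong +_ root))) (res-pos j m))) })

res0⇒3* : ∀ x → res x ≡ 0F → ∃[ t ] x ≡ + 3 *ℤ t
res0⇒3* x eq = let t , p = res-quotient x in t , trans p (trans (cong (λ c → ι c +ℤ + 3 *ℤ t) eq) (ℤ.+-identityˡ _))

res-3* : ∀ t → res (+ 3 *ℤ t) ≡ 0F
res-3* t = res-unique 0F t (sym (ℤ.+-identityˡ (+ 3 *ℤ t)))

root-3* : ∀ n t → IsRoot (n * 3) (+ 3 *ℤ t) → + n ≡ + 3 *ℤ (t *ℤ t)
root-3* n t root = ℤ.*-cancelʳ-≡ (+ n) (+ 3 *ℤ (t *ℤ t)) (+ 3)
  (trans (sym (ℤ.pos-* n 3)) (trans (cong +_ (sym root)) (trans (sym (square-abs (+ 3 *ℤ t))) (rearrange t))))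
  where
  rearrange : ∀ t → + 3 *ℤ t *ℤ (+ 3 *ℤ t) ≡ + 3 *ℤ (t *ℤ t) *ℤ + 3
  rearrange = solve-∀

θ₀-vanishes : ∀ j m → res (+ j) ≢ 0F → θ 0F ((j + m * 3) * 3) ≡ 0ℤ
θ₀-vanishes j m j≢ = cong +_ (size-empty (class 0F ((j + m * 3) * 3)) empty)
  where
  empty : ∀ x → ¬ (IsRoot ((j + m * 3) * 3) x × res x ≡ 0F)
  empty x (root , r) with res0⇒3* x r
  ... | t , refl = j≢ (trans (sym (res-pos j m)) (trans (cong res (root-3* (j + m * 3) t root)) (res-3* (t *ℤ t))))

θ₀-9 : ∀ m → φ m ≡ θ 0F (m * 3 * 3)
θ₀-9 m = cong +_ (size-image (roots m) (class 0F (m * 3 * 3)) (+ 3 *ℤ_) (ℤ.*-cancelˡ-≡ (+ 3) _ _) into onto)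
  where
  square : ∀ t → ∣ + 3 *ℤ t ∣ * ∣ + 3 *ℤ t ∣ ≡ ∣ t ∣ * ∣ t ∣ * 3 * 3
  square t = ℤ.+-injective (trans (sym (square-abs (+ 3 *ℤ t))) (trans (rearrange t)
    (trans (cong (λ y → y *ℤ + 3 *ℤ + 3) (square-abs t))
     (trans (cong (_*ℤ + 3) (sym (ℤ.pos-* (∣ t ∣ * ∣ t ∣) 3))) (sym (ℤ.pos-* (∣ t ∣ * ∣ t ∣ * 3) 3))))))
    where
    rearrange : ∀ t → + 3 *ℤ t *ℤ (+ 3 *ℤ t) ≡ t *ℤ t *ℤ + 3 *ℤ + 3
    rearrange = solve-∀
  into : ∀ t → IsRoot m t → IsRoot (m * 3 * 3) (+ 3 *ℤ t) × res (+ 3 *ℤ t) ≡ 0F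
  into t refl = square t , res-3* t
  onto : ∀ x → IsRoot (m * 3 * 3) x × res x ≡ 0F → ∃[ t ] IsRoot m t × + 3 *ℤ t ≡ x
  onto x (root , r) with res0⇒3* x r
  ... | t , refl = t , ℕ.*-cancelʳ-≡ _ _ 3 (ℕ.*-cancelʳ-≡ _ _ 3 (trans (sym (square t)) root)) , refl

-- The squares involved are 9t². Divisibility of the exponents by 3 is used once for `θ 0F` and once
-- more for `U (θ 0F)`.
θ₀≈VVφ : θ 0F ≈ V (V φ)
θ₀≈VVφ = ≈-sym (≈-trans
  (V-cong (≈-trans (V-cong (pointwise θ₀-9))
    (V-U (U (θ 0F)) (λ m → θ₀-vanishes 1 m λ ()) (λ m → θ₀-vanishes 2 m λ ()))))
  (V-U (θ 0F) (λ m → θ-vanishes 0F 1 m λ ()) (λ m → θ-vanishes 0F 2 m λ ())))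

-- With x = 1 + 3k one has (x² - 1)/3 = 3k² + 2k, so ω is the sum of q^(3k²+2k) over all integers k.
ω : Series
ω = U (tail (θ 1F))

θ₁≈qVω : θ 1F ≈ X 1 ⊛ V ω
θ₁≈qVω = pointwise λ
  { zero    → trans (θ-vanishes 1F 0 0 λ ()) (sym (at (X1-⊛ (V ω)) 0))
  -- `tail` lowers exponents by one: degrees 1 and 2 modulo 3 of the tail are exponents 2 and 0
  -- modulo 3 of `θ 1F`, the latter starting at 3, whence `suc m`.
  ; (suc n) → trans (sym (at (V-U (tail (θ 1F)) (λ m → θ-vanishes 1F 2 m λ ()) (λ m → θ-vanishes 1F 0 (suc m) λ ())) n))
                    (sym (at (X1-⊛ (V ω)) (suc n))) }

-- Sums of squares with prescribed residues

reps : ∀ k n → Enumeration (λ xs → sumOfSquaresℕ {k} xs ≡ n)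
reps k n = transport
  (λ xs eq → ℤ.+-injective (trans (sym (sumOfSquares-abs xs)) eq))
  (λ xs eq → trans (sumOfSquares-abs xs) (cong +_ eq)) (representations k n)

coded : ∀ {k} (cs : Vec (Fin 3) k) n → Enumeration (λ xs → sumOfSquaresℕ xs ≡ n × Vec.map res xs ≡ cs)
coded cs n = restrict (λ xs → Vec.≡-dec Fin._≟_ (Vec.map res xs) cs) (reps _ n)

-- Norms add when a coordinate is prepended. One statement serves both unrestricted vectors, giving
-- powers of φ, and vectors with prescribed residues, giving products of the `θ c`.
count-∷ : ∀ {k} {P : ℕ → ℤ → Set} {Q : ℕ → Vec ℤ k → Set} {R : ℕ → Vec ℤ (suc k) → Set}
  (eP : ∀ n → Enumeration (P n)) (eQ : ∀ n → Enumeration (Q n)) (eR : ∀ n → Enumeration (R n)) →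
  (∀ {i j x} → P i x → P j x → i ≡ j) →
  (∀ {i j x xs} → P i x → Q j xs → R (i + j) (x ∷ xs)) →
  (∀ {n x xs} → R n (x ∷ xs) → ∃[ i ] ∃[ j ] i + j ≡ n × P i x × Q j xs) →
  count eR ≈ count eP ⊛ count eQ
count-∷ {P = P} {Q} {R} eP eQ eR graded cons uncons = pointwise λ n → trans
  (cong +_ (sym (size-image (conv eQ eP graded n) (eR n) (λ (x , xs) → x ∷ xs)
     (λ eq → cong₂ _,_ (Vec.∷-injectiveˡ eq) (Vec.∷-injectiveʳ eq)) (into n) (onto n))))
  (count-conv eQ eP graded n)
  where
  into : ∀ n p → Conv P Q n p → R n (proj₁ p ∷ proj₂ p)
  into n (x , xs) c with conv-elim P Q n c
  ... | _ , _ , refl , p , q = cons p q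
  onto : ∀ n ys → R n ys → ∃[ p ] Conv P Q n p × proj₁ p ∷ proj₂ p ≡ ys
  onto n (x ∷ xs) r with uncons r
  ... | i , _ , refl , p , q = (x , xs) , conv-intro P Q i p q , refl

r-series : ℕ → Series
r-series k n = + r k n

r-zero : r-series 0 ≈ const 1ℤ
r-zero = pointwise λ
  { zero    → refl
  ; (suc n) → cong +_ (size-empty (reps 0 (suc n)) (λ { [] () })) }

r-suc : ∀ k → r-series (suc k) ≈ φ ⊛ r-series k
r-suc k = count-∷ roots (reps k) (reps (suc k)) (λ p p′ → trans (sym p) p′) (cong₂ _+_)
  (λ eq → _ , _ , eq , refl , refl)

r-series-φ : ∀ k → r-series k ≈ φ ^ˢ k
r-series-φ zero    = r-zero
r-series-φ (suc k) = ≈-trans (r-suc k) (⊛-cong (≈-refl {φ}) (r-series-φ k))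

coded-[] : count (coded []) ≈ const 1ℤ
coded-[] = ≈-trans (pointwise λ n → cong +_ (size-cong (coded [] n) (reps 0 n) (λ _ → proj₁) (λ { [] eq → eq , refl }))) r-zero

coded-∷ : ∀ {k} c (cs : Vec (Fin 3) k) → count (coded (c ∷ cs)) ≈ θ c ⊛ count (coded cs)
coded-∷ c cs = count-∷ (class c) (coded cs) (coded (c ∷ cs)) (λ (p , _) (p′ , _) → trans (sym p) p′)
  (λ (p , q) (p′ , q′) → cong₂ _+_ p p′ , cong₂ _∷_ q q′)
  (λ (eq , eq′) → _ , _ , eq , (refl , Vec.∷-injectiveˡ eq′) , (refl , Vec.∷-injectiveʳ eq′))

coded₄ : ∀ a b c d → count (coded (a ∷ b ∷ c ∷ d ∷ [])) ≈ θ a ⊛ (θ b ⊛ (θ c ⊛ θ d))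
coded₄ a b c d = ≈-trans (coded-∷ a (b ∷ c ∷ d ∷ [])) (⊛-cong (≈-refl {θ a})
  (≈-trans (coded-∷ b (c ∷ d ∷ [])) (⊛-cong (≈-refl {θ b})
  (≈-trans (coded-∷ c (d ∷ [])) (⊛-cong (≈-refl {θ c})
  (≈-trans (coded-∷ d []) (≈-trans (⊛-cong (≈-refl {θ d}) coded-[])
    (≈-trans (⊛-comm (θ d) (const 1ℤ)) (⊛-identityˡ (θ d))))))))))

-- The tetracode and its lattice

sum₃ : Fin 3 → Fin 3 → Fin 3
sum₃ c d = res (ι c +ℤ ι d)

diff₃ : Fin 3 → Fin 3 → Fin 3
diff₃ c d = res (ι c -ℤ ι d)

-- The self-dual ternary code of length 4, in the form where the last two coordinates are free: nine
-- words, namely zero and eight words of weight 3.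
Tetracode : Vec ℤ 4 → Set
Tetracode (y₁ ∷ y₂ ∷ y₃ ∷ y₄ ∷ []) = res y₁ ≡ sum₃ (res y₃) (res y₄) × res y₂ ≡ diff₃ (res y₃) (res y₄)

tetra : ∀ n → Enumeration (λ ys → sumOfSquaresℕ ys ≡ n × Tetracode ys)
tetra n = restrict (λ { (y₁ ∷ y₂ ∷ y₃ ∷ y₄ ∷ []) → (_ Fin.≟ _) ×-dec (_ Fin.≟ _) }) (reps 4 n)

coord₃ coord₄ : Vec ℤ 4 → Fin 3
coord₃ (_ ∷ _ ∷ y ∷ _) = res y
coord₄ (_ ∷ _ ∷ _ ∷ y ∷ []) = res y

-- This is the weight enumerator a⁴ + 8ab³ of the code. Splitting by the third coordinate, then by
-- the fourth, lists the nine words; a zero entry contributes a = `θ 0F` and a nonzero entry b =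
-- `θ 1F`.
tetra-sum : ∀ n → count tetra n ≡ (θ 0F ^ˢ 4 ⊕ const (+ 8) ⊛ (θ 0F ⊛ θ 1F ^ˢ 3)) n
tetra-sum n = trans
  (cong +_ (trans (size-by-residue (tetra n) coord₃ part)
    (cong₂ _+_ (byCoord₄ 0F) (cong₂ _+_ (byCoord₄ 1F) (byCoord₄ 2F)))))
  (trans (cong₂ _+ℤ_ (row 0F) (cong₂ _+ℤ_ (row 1F) (row 2F)))
    (at (solve 2 (λ a b →
        (a :* (a :* (a :* a)) :+ (b :* (b :* (a :* b)) :+ b :* (b :* (a :* b))))
        :+ ((b :* (b :* (b :* a)) :+ (b :* (a :* (b :* b)) :+ a :* (b :* (b :* b))))
        :+ (b :* (b :* (b :* a)) :+ (a :* (b :* (b :* b)) :+ b :* (a :* (b :* b)))))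
        := a :^ 4 :+ con (+ 8) :* (a :* b :^ 3)) ≈-refl (θ 0F) (θ 1F)) n))
  where
  part : ∀ c → Enumeration (λ ys → (sumOfSquaresℕ ys ≡ n × Tetracode ys) × coord₃ ys ≡ c)
  part c = restrict (λ ys → coord₃ ys Fin.≟ c) (tetra n)
  word : Fin 3 → Fin 3 → Vec (Fin 3) 4
  word c d = sum₃ c d ∷ diff₃ c d ∷ c ∷ d ∷ []
  part′ : ∀ c d → Enumeration (λ ys → ((sumOfSquaresℕ ys ≡ n × Tetracode ys) × coord₃ ys ≡ c) × coord₄ ys ≡ d)
  part′ c d = transport
    (λ { (y₁ ∷ y₂ ∷ y₃ ∷ y₄ ∷ []) (eq , w) → from (res y₁) (res y₂) (res y₃) (res y₄) eq w })
    (λ { (y₁ ∷ y₂ ∷ y₃ ∷ y₄ ∷ []) (((eq , p , p′) , q) , q′) → eq , to (res y₁) (res y₂) (res y₃) (res y₄) p p′ q q′ })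
    (coded (word c d) n)
    where
    -- The residues are generalized to variables, so that matching on `refl` can identify them with
    -- the entries of the word.
    from : ∀ {P : Set} a b a′ b′ → P → a ∷ b ∷ a′ ∷ b′ ∷ [] ≡ word c d →
      ((P × (a ≡ sum₃ a′ b′ × b ≡ diff₃ a′ b′)) × a′ ≡ c) × b′ ≡ d
    from _ _ _ _ eq refl = ((eq , refl , refl) , refl) , refl
    to : ∀ a b a′ b′ → a ≡ sum₃ a′ b′ → b ≡ diff₃ a′ b′ → a′ ≡ c → b′ ≡ d → a ∷ b ∷ a′ ∷ b′ ∷ [] ≡ word c d
    to _ _ _ _ refl refl refl refl = refl
  byCoord₄ : ∀ c → size (part c) ≡ size (coded (word c 0F) n) + (size (coded (word c 1F) n) + size (coded (word c 2F) n))
  byCoord₄ c = size-by-residue (part c) coord₄ (part′ c)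
  -- With both nonzero residues sent to `θ 1F` by computation, the solver meets only two atoms.
  θ′ : Fin 3 → Series
  θ′ 0F = θ 0F
  θ′ _  = θ 1F
  θ≈θ′ : ∀ c → θ c ≈ θ′ c
  θ≈θ′ 0F = ≈-refl
  θ≈θ′ 1F = ≈-refl
  θ≈θ′ 2F = θ₂≈θ₁
  entry : ∀ a b c d → count (coded (a ∷ b ∷ c ∷ d ∷ [])) n ≡ (θ′ a ⊛ (θ′ b ⊛ (θ′ c ⊛ θ′ d))) n
  entry a b c d = at (≈-trans (coded₄ a b c d) (⊛-cong (θ≈θ′ a) (⊛-cong (θ≈θ′ b) (⊛-cong (θ≈θ′ c) (θ≈θ′ d))))) n
  product′ : Fin 3 → Fin 3 → Series
  product′ c d = θ′ (sum₃ c d) ⊛ (θ′ (diff₃ c d) ⊛ (θ′ c ⊛ θ′ d))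
  row : ∀ c → + (size (coded (word c 0F) n) + (size (coded (word c 1F) n) + size (coded (word c 2F) n)))
      ≡ (product′ c 0F ⊕ (product′ c 1F ⊕ product′ c 2F)) n
  row c = cong₂ _+ℤ_ (entry _ _ c 0F) (cong₂ _+ℤ_ (entry _ _ c 1F) (entry _ _ c 2F))

-- A symmetric matrix M with M² = 3, whose columns span the tetracode modulo 3.
rotate : Vec ℤ 4 → Vec ℤ 4
rotate (a ∷ b ∷ c ∷ d ∷ []) = (a +ℤ b +ℤ c) ∷ (a -ℤ b +ℤ d) ∷ (a -ℤ c -ℤ d) ∷ (b -ℤ c +ℤ d) ∷ []

rotate-norm : ∀ xs → sumOfSquaresℕ (rotate xs) ≡ sumOfSquaresℕ xs * 3
rotate-norm xs@(a ∷ b ∷ c ∷ d ∷ []) = ℤ.+-injective (begin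
  + sumOfSquaresℕ (rotate xs)  ≡⟨ sumOfSquares-abs (rotate xs) ⟨
  sumOfSquares (rotate xs)     ≡⟨ expand a b c d ⟩
  sumOfSquares xs *ℤ + 3       ≡⟨ cong (_*ℤ + 3) (sumOfSquares-abs xs) ⟩
  + sumOfSquaresℕ xs *ℤ + 3    ≡⟨ ℤ.pos-* (sumOfSquaresℕ xs) 3 ⟨
  + (sumOfSquaresℕ xs * 3) ∎)
  where
  open ≡-Reasoning
  expand : ∀ a b c d → (a +ℤ b +ℤ c) *ℤ (a +ℤ b +ℤ c) +ℤ ((a -ℤ b +ℤ d) *ℤ (a -ℤ b +ℤ d) +ℤ
    ((a -ℤ c -ℤ d) *ℤ (a -ℤ c -ℤ d) +ℤ ((b -ℤ c +ℤ d) *ℤ (b -ℤ c +ℤ d) +ℤ 0ℤ)))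
    ≡ (a *ℤ a +ℤ (b *ℤ b +ℤ (c *ℤ c +ℤ (d *ℤ d +ℤ 0ℤ)))) *ℤ + 3
  expand = solve-∀

rotate² : ∀ xs → rotate (rotate xs) ≡ Vec.map (+ 3 *ℤ_) xs
rotate² (a ∷ b ∷ c ∷ d ∷ []) =
  cong₂ _∷_ (e₁ a b c d) (cong₂ _∷_ (e₂ a b c d) (cong₂ _∷_ (e₃ a b c d) (cong₂ _∷_ (e₄ a b c d) refl)))
  where
  e₁ : ∀ a b c d → (a +ℤ b +ℤ c) +ℤ (a -ℤ b +ℤ d) +ℤ (a -ℤ c -ℤ d) ≡ + 3 *ℤ a
  e₁ = solve-∀
  e₂ : ∀ a b c d → (a +ℤ b +ℤ c) -ℤ (a -ℤ b +ℤ d) +ℤ (b -ℤ c +ℤ d) ≡ + 3 *ℤ b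
  e₂ = solve-∀
  e₃ : ∀ a b c d → (a +ℤ b +ℤ c) -ℤ (a -ℤ c -ℤ d) -ℤ (b -ℤ c +ℤ d) ≡ + 3 *ℤ c
  e₃ = solve-∀
  e₄ : ∀ a b c d → (a -ℤ b +ℤ d) -ℤ (a -ℤ c -ℤ d) +ℤ (b -ℤ c +ℤ d) ≡ + 3 *ℤ d
  e₄ = solve-∀

rotate-injective : ∀ {xs ys} → rotate xs ≡ rotate ys → xs ≡ ys
rotate-injective {xs} {ys} eq = triple-injective xs ys
  (trans (sym (rotate² xs)) (trans (cong rotate eq) (rotate² ys)))
  where
  triple-injective : ∀ {k} (xs ys : Vec ℤ k) → Vec.map (+ 3 *ℤ_) xs ≡ Vec.map (+ 3 *ℤ_) ys → xs ≡ ys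
  triple-injective []       []       _  = refl
  triple-injective (x ∷ xs) (y ∷ ys) eq = cong₂ _∷_ (ℤ.*-cancelˡ-≡ (+ 3) x y (Vec.∷-injectiveˡ eq))
                                                    (triple-injective xs ys (Vec.∷-injectiveʳ eq))

rotate-tetracode : ∀ xs → Tetracode (rotate xs)
rotate-tetracode (a ∷ b ∷ c ∷ d ∷ []) =
    trans (res-cong _ (y₃ +ℤ y₄) c (e₁ a b c d)) (res-plus y₃ y₄)
  , trans (res-cong _ (y₃ -ℤ y₄) d (e₂ a b c d)) (res-minus y₃ y₄)
  where
  y₃ = a -ℤ c -ℤ d
  y₄ = b -ℤ c +ℤ d
  e₁ : ∀ a b c d → a +ℤ b +ℤ c ≡ (a -ℤ c -ℤ d) +ℤ (b -ℤ c +ℤ d) +ℤ + 3 *ℤ c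
  e₁ = solve-∀
  e₂ : ∀ a b c d → a -ℤ b +ℤ d ≡ (a -ℤ c -ℤ d) -ℤ (b -ℤ c +ℤ d) +ℤ + 3 *ℤ d
  e₂ = solve-∀

-- The last two entries c, d of the preimage are the quotients by 3 in the two code conditions. The
-- third and fourth coordinates of the image then force the first two entries, and the code
-- conditions are what makes the remaining coordinates agree.
rotate-onto : ∀ ys → Tetracode ys → ∃[ xs ] rotate xs ≡ ys
rotate-onto (y₁ ∷ y₂ ∷ y₃ ∷ y₄ ∷ []) (p , q) =
  let c , eq  = res-≡⇒ y₁ (y₃ +ℤ y₄) (trans p (sym (res-plus y₃ y₄)))
      d , eq′ = res-≡⇒ y₂ (y₃ -ℤ y₄) (trans q (sym (res-minus y₃ y₄)))
  in (y₃ +ℤ c +ℤ d) ∷ (y₄ +ℤ c -ℤ d) ∷ c ∷ d ∷ [] , preimage c d eq eq′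
  where
  e₁ : ∀ y z c d → (y +ℤ c +ℤ d) +ℤ (z +ℤ c -ℤ d) +ℤ c ≡ y +ℤ z +ℤ + 3 *ℤ c
  e₁ = solve-∀
  e₂ : ∀ y z c d → (y +ℤ c +ℤ d) -ℤ (z +ℤ c -ℤ d) +ℤ d ≡ y -ℤ z +ℤ + 3 *ℤ d
  e₂ = solve-∀
  e₃ : ∀ y c d → (y +ℤ c +ℤ d) -ℤ c -ℤ d ≡ y
  e₃ = solve-∀
  e₄ : ∀ z c d → (z +ℤ c -ℤ d) -ℤ c +ℤ d ≡ z
  e₄ = solve-∀
  preimage : ∀ c d → y₁ ≡ y₃ +ℤ y₄ +ℤ + 3 *ℤ c → y₂ ≡ y₃ -ℤ y₄ +ℤ + 3 *ℤ d →
    rotate ((y₃ +ℤ c +ℤ d) ∷ (y₄ +ℤ c -ℤ d) ∷ c ∷ d ∷ []) ≡ y₁ ∷ y₂ ∷ y₃ ∷ y₄ ∷ []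
  preimage c d eq eq′ =
    cong₂ _∷_ (trans (e₁ y₃ y₄ c d) (sym eq)) (cong₂ _∷_ (trans (e₂ y₃ y₄ c d) (sym eq′))
      (cong₂ _∷_ (e₃ y₃ c d) (cong₂ _∷_ (e₄ y₄ c d) refl)))

r₄-tetra : ∀ n → r 4 n ≡ size (tetra (n * 3))
r₄-tetra n = size-image (reps 4 n) (tetra (n * 3)) rotate rotate-injective
  (λ { xs refl → rotate-norm xs , rotate-tetracode xs }) onto
  where
  onto : ∀ ys → sumOfSquaresℕ ys ≡ n * 3 × Tetracode ys → ∃[ xs ] sumOfSquaresℕ xs ≡ n × rotate xs ≡ ys
  onto ys (norm , code) with rotate-onto ys code
  ... | xs , refl = xs , ℕ.*-cancelʳ-≡ _ n 3 (trans (sym (rotate-norm xs)) norm) , refl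

φ⁴-tetra : φ ^ˢ 4 ≈ U (θ 0F ^ˢ 4 ⊕ const (+ 8) ⊛ (θ 0F ⊛ θ 1F ^ˢ 3))
φ⁴-tetra = ≈-trans (≈-sym (r-series-φ 4)) (pointwise λ n → trans (cong +_ (r₄-tetra n)) (tetra-sum (n * 3)))

-- Dissection of the powers of φ modulo 9

φ₃ : Series
φ₃ = V φ

φ-dissection : φ ≈ dissect φ₃ (const (+ 2) ⊛ ω) (const 0ℤ)
φ-dissection = begin
  φ
    ≈⟨ φ-split ⟩
  θ 0F ⊕ const (+ 2) ⊛ θ 1F
    ≈⟨ ⊕-cong θ₀≈VVφ (⊛-cong (≈-refl {const (+ 2)}) θ₁≈qVω) ⟩
  V φ₃ ⊕ const (+ 2) ⊛ (X 1 ⊛ V ω)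
    ≈⟨ solve 3 (λ a x w → a :+ con (+ 2) :* (x :* w) := a :+ x :* (con (+ 2) :* w) :+ x :^ 2 :* con 0ℤ)
         ≈-refl (V φ₃) (X 1) (V ω) ⟩
  V φ₃ ⊕ X 1 ⊛ (const (+ 2) ⊛ V ω) ⊕ X 1 ^ˢ 2 ⊛ const 0ℤ
    ≈⟨ ⊕-cong (⊕-congˡ (V φ₃) (⊛-cong (≈-refl {X 1})
      (≈-trans (⊛-cong (≈-sym (V-const (+ 2))) ≈-refl) (≈-sym (V-⊛ (const (+ 2)) ω)))))
      (⊛-cong (≈-refl {X 1 ^ˢ 2}) (≈-sym (V-const 0ℤ))) ⟩
  dissect φ₃ (const (+ 2) ⊛ ω) (const 0ℤ) ∎
  where open ≈-Reasoning

-- After substituting V φ₃ for `θ 0F` and q V ω for `θ 1F`, the cube (q V ω)³ equals V (q ω³). The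
-- whole expression is therefore in the image of V, and U undoes V.
φ⁴-identity : φ ^ˢ 4 ≈ φ₃ ^ˢ 4 ⊕ const (+ 8) ⊛ (φ₃ ⊛ (X 1 ⊛ ω ^ˢ 3))
φ⁴-identity = ≈-trans φ⁴-tetra (≈-trans (U-cong expand) (pointwise (V-at-*3 _)))
  where
  open ≈-Reasoning
  V-^ : ∀ f k → V f ^ˢ k ≈ V (f ^ˢ k)
  V-^ f zero    = ≈-sym (V-const 1ℤ)
  V-^ f (suc k) = ≈-trans (⊛-cong (≈-refl {V f}) (V-^ f k)) (≈-sym (V-⊛ f (f ^ˢ k)))
  V-times : ∀ {f g f′ g′} → f′ ≈ V f → g′ ≈ V g → f′ ⊛ g′ ≈ V (f ⊛ g)
  V-times {f} {g} p q = ≈-trans (⊛-cong p q) (≈-sym (V-⊛ f g))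
  expand : θ 0F ^ˢ 4 ⊕ const (+ 8) ⊛ (θ 0F ⊛ θ 1F ^ˢ 3) ≈ V (φ₃ ^ˢ 4 ⊕ const (+ 8) ⊛ (φ₃ ⊛ (X 1 ⊛ ω ^ˢ 3)))
  expand = begin
    θ 0F ^ˢ 4 ⊕ const (+ 8) ⊛ (θ 0F ⊛ θ 1F ^ˢ 3)
      ≈⟨ ⊕-cong (^ˢ-congˡ 4 θ₀≈VVφ) (⊛-cong (≈-refl {const (+ 8)}) (⊛-cong θ₀≈VVφ (^ˢ-congˡ 3 θ₁≈qVω))) ⟩
    V φ₃ ^ˢ 4 ⊕ const (+ 8) ⊛ (V φ₃ ⊛ (X 1 ⊛ V ω) ^ˢ 3)
      ≈⟨ solve 3 (λ a x w → a :^ 4 :+ con (+ 8) :* (a :* (x :* w) :^ 3) :=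
                            a :^ 4 :+ con (+ 8) :* (a :* (x :^ 3 :* w :^ 3))) ≈-refl (V φ₃) (X 1) (V ω) ⟩
    V φ₃ ^ˢ 4 ⊕ const (+ 8) ⊛ (V φ₃ ⊛ (X 1 ^ˢ 3 ⊛ V ω ^ˢ 3))
      ≈⟨ ⊕-cong (V-^ φ₃ 4) (V-times (≈-sym (V-const (+ 8))) (V-times (≈-refl {V φ₃}) (V-times (≈-sym V-X1) (V-^ ω 3)))) ⟩
    V (φ₃ ^ˢ 4) ⊕ V (const (+ 8) ⊛ (φ₃ ⊛ (X 1 ⊛ ω ^ˢ 3)))
      ≈⟨ ≈-sym (V-⊕ (φ₃ ^ˢ 4) (const (+ 8) ⊛ (φ₃ ⊛ (X 1 ⊛ ω ^ˢ 3)))) ⟩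
    V (φ₃ ^ˢ 4 ⊕ const (+ 8) ⊛ (φ₃ ⊛ (X 1 ⊛ ω ^ˢ 3))) ∎

-- The components of φ⁴ in degrees 0, 1, 2 modulo 3, obtained by squaring the dissection of φ² into
-- φ₃², 4 φ₃ ω and 4 ω².
A₀ A₁ A₂ : Series
A₀ = φ₃ ^ˢ 4 ⊕ const (+ 32) ⊛ (φ₃ ⊛ (X 1 ⊛ ω ^ˢ 3))
A₁ = const (+ 8) ⊛ (φ₃ ^ˢ 3 ⊛ ω) ⊕ const (+ 16) ⊛ (X 1 ⊛ ω ^ˢ 4)
A₂ = const (+ 24) ⊛ (φ₃ ^ˢ 2 ⊛ ω ^ˢ 2)

φ²-dissection : φ ⊛ φ ≈ dissect (φ₃ ^ˢ 2) (const (+ 4) ⊛ (φ₃ ⊛ ω)) (const (+ 4) ⊛ ω ^ˢ 2)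
φ²-dissection = ≈-trans (⊛-cong φ-dissection φ-dissection)
  (≈-trans (dissect-⊛ φ₃ (const (+ 2) ⊛ ω) (const 0ℤ) φ₃ (const (+ 2) ⊛ ω) (const 0ℤ))
    (dissect-cong
      (solve 3 (λ x a w → a :* a :+ x :* (con (+ 2) :* w :* con 0ℤ :+ con 0ℤ :* (con (+ 2) :* w)) := a :^ 2)
         ≈-refl (X 1) φ₃ ω)
      (solve 3 (λ x a w → a :* (con (+ 2) :* w) :+ con (+ 2) :* w :* a :+ x :* (con 0ℤ :* con 0ℤ) := con (+ 4) :* (a :* w))
         ≈-refl (X 1) φ₃ ω)
      (solve 2 (λ a w → a :* con 0ℤ :+ con (+ 2) :* w :* (con (+ 2) :* w) :+ con 0ℤ :* a := con (+ 4) :* w :^ 2)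
         ≈-refl φ₃ ω)))

φ⁴-dissection : (φ ⊛ φ) ⊛ (φ ⊛ φ) ≈ dissect A₀ A₁ A₂
φ⁴-dissection = ≈-trans (⊛-cong φ²-dissection φ²-dissection)
  (≈-trans (dissect-⊛ B₀ B₁ B₂ B₀ B₁ B₂)
    (dissect-cong
      (solve 3 (λ x a w → let b = a :^ 2 ; c = con (+ 4) :* (a :* w) ; d = con (+ 4) :* w :^ 2 in
          b :* b :+ x :* (c :* d :+ d :* c) := a :^ 4 :+ con (+ 32) :* (a :* (x :* w :^ 3))) ≈-refl (X 1) φ₃ ω)
      (solve 3 (λ x a w → let b = a :^ 2 ; c = con (+ 4) :* (a :* w) ; d = con (+ 4) :* w :^ 2 in
          b :* c :+ c :* b :+ x :* (d :* d) := con (+ 8) :* (a :^ 3 :* w) :+ con (+ 16) :* (x :* w :^ 4)) ≈-refl (X 1) φ₃ ω)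
      (solve 2 (λ a w → let b = a :^ 2 ; c = con (+ 4) :* (a :* w) ; d = con (+ 4) :* w :^ 2 in
          b :* d :+ c :* c :+ d :* b := con (+ 24) :* (a :^ 2 :* w :^ 2)) ≈-refl φ₃ ω)))
  where
  B₀ = φ₃ ^ˢ 2
  B₁ = const (+ 4) ⊛ (φ₃ ⊛ ω)
  B₂ = const (+ 4) ⊛ ω ^ˢ 2

U-φ⁸ : ∃[ h ] U (φ ^ˢ 8) ≈ φ ^ˢ 8 ⊕ const (+ 9) ⊛ h
U-φ⁸ = h , (begin
  U (φ ^ˢ 8)
    ≈⟨ U-cong (≈-trans (solve 1 (λ f → f :^ 8 := (f :* f) :* (f :* f) :* ((f :* f) :* (f :* f))) ≈-refl φ)
         (≈-trans (⊛-cong φ⁴-dissection φ⁴-dissection) (dissect-⊛ A₀ A₁ A₂ A₀ A₁ A₂))) ⟩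
  -- Only the component in degree 0 modulo 3 survives U; the other two are left to inference.
  U (dissect (A₀ ⊛ A₀ ⊕ X 1 ⊛ (A₁ ⊛ A₂ ⊕ A₂ ⊛ A₁)) _ _)
    ≈⟨ U-dissect _ _ _ ⟩
  A₀ ⊛ A₀ ⊕ X 1 ⊛ (A₁ ⊛ A₂ ⊕ A₂ ⊛ A₁)
    ≈⟨ solve 3 (λ x a w →
         let a₀ = a :^ 4 :+ con (+ 32) :* (a :* (x :* w :^ 3))
             a₁ = con (+ 8) :* (a :^ 3 :* w) :+ con (+ 16) :* (x :* w :^ 4)
             a₂ = con (+ 24) :* (a :^ 2 :* w :^ 2)
         in a₀ :* a₀ :+ x :* (a₁ :* a₂ :+ a₂ :* a₁) :=
            (a :^ 4 :+ con (+ 8) :* (a :* (x :* w :^ 3))) :^ 2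
              :+ con (+ 9) :* (con (+ 48) :* (a :^ 5 :* (x :* w :^ 3)) :+ con (+ 192) :* (a :^ 2 :* (x :^ 2 :* w :^ 6))))
       ≈-refl (X 1) φ₃ ω ⟩
  (φ₃ ^ˢ 4 ⊕ const (+ 8) ⊛ (φ₃ ⊛ (X 1 ⊛ ω ^ˢ 3))) ^ˢ 2 ⊕ const (+ 9) ⊛ h
    ≈⟨ ⊕-cong (^ˢ-congˡ 2 (≈-sym φ⁴-identity)) (≈-refl {const (+ 9) ⊛ h}) ⟩
  (φ ^ˢ 4) ^ˢ 2 ⊕ const (+ 9) ⊛ h
    ≈⟨ solve 2 (λ f y → (f :^ 4) :^ 2 :+ y := f :^ 8 :+ y) ≈-refl φ (const (+ 9) ⊛ h) ⟩
  φ ^ˢ 8 ⊕ const (+ 9) ⊛ h ∎)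
  where
  open ≈-Reasoning
  -- U φ⁸ = φ₃⁸ + 448 q φ₃⁵ ω³ + 1792 q² φ₃² ω⁶, while φ⁸ has 16 and 64 in place of 448 and 1792.
  -- The differences are 432 = 9 · 48 and 1728 = 9 · 192.
  h = const (+ 48) ⊛ (φ₃ ^ˢ 5 ⊛ (X 1 ⊛ ω ^ˢ 3)) ⊕ const (+ 192) ⊛ (φ₃ ^ˢ 2 ⊛ (X 1 ^ˢ 2 ⊛ ω ^ˢ 6))

-- ψ³ is an exact inverse of φ³, so the relation `φ³-U` may be multiplied by ψ³. The witness
-- collects the errors of `ninth-power` and `U-φ⁸`, both multiplied by ψ³.
U-inverse : ∃[ h ] U (ε p̄-series) ≈ φ ^ˢ 5 ⊕ const (+ 9) ⊛ h
U-inverse = ψ ^ˢ 3 ⊛ (k ⊕ ⊖ U (h ⊛ ψ)) , (begin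
  U ψ
    ≈⟨ solve 1 (λ u → u := con 1ℤ :^ 3 :* u) ≈-refl (U ψ) ⟩
  const 1ℤ ^ˢ 3 ⊛ U ψ
    ≈⟨ ⊛-cong (^ˢ-congˡ 3 (≈-sym εp̄-⊛-φ)) (≈-refl {U ψ}) ⟩
  (ψ ⊛ φ) ^ˢ 3 ⊛ U ψ
    ≈⟨ solve 4 (λ q f u y → (q :* f) :^ 3 :* u := q :^ 3 :* (f :^ 3 :* u :+ con (+ 9) :* y :- con (+ 9) :* y))
         ≈-refl ψ φ (U ψ) (U (h ⊛ ψ)) ⟩
  ψ ^ˢ 3 ⊛ (φ ^ˢ 3 ⊛ U ψ ⊕ const (+ 9) ⊛ U (h ⊛ ψ) ⊕ ⊖ (const (+ 9) ⊛ U (h ⊛ ψ)))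
    ≈⟨ ⊛-cong (≈-refl {ψ ^ˢ 3}) (⊕-cong φ³-U (≈-refl {⊖ (const (+ 9) ⊛ U (h ⊛ ψ))})) ⟩
  ψ ^ˢ 3 ⊛ (φ ^ˢ 8 ⊕ const (+ 9) ⊛ k ⊕ ⊖ (const (+ 9) ⊛ U (h ⊛ ψ)))
    ≈⟨ solve 4 (λ q f k y → q :^ 3 :* (f :^ 8 :+ con (+ 9) :* k :- con (+ 9) :* y) :=
                 (q :* f) :^ 3 :* f :^ 5 :+ con (+ 9) :* (q :^ 3 :* (k :- y))) ≈-refl ψ φ k (U (h ⊛ ψ)) ⟩
  (ψ ⊛ φ) ^ˢ 3 ⊛ φ ^ˢ 5 ⊕ const (+ 9) ⊛ (ψ ^ˢ 3 ⊛ (k ⊕ ⊖ U (h ⊛ ψ)))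
    ≈⟨ ⊕-cong (⊛-cong (^ˢ-congˡ 3 εp̄-⊛-φ) (≈-refl {φ ^ˢ 5})) (≈-refl {const (+ 9) ⊛ (ψ ^ˢ 3 ⊛ (k ⊕ ⊖ U (h ⊛ ψ)))}) ⟩
  const 1ℤ ^ˢ 3 ⊛ φ ^ˢ 5 ⊕ const (+ 9) ⊛ (ψ ^ˢ 3 ⊛ (k ⊕ ⊖ U (h ⊛ ψ)))
    ≈⟨ solve 2 (λ f y → con 1ℤ :^ 3 :* f :+ y := f :+ y) ≈-refl (φ ^ˢ 5) (const (+ 9) ⊛ (ψ ^ˢ 3 ⊛ (k ⊕ ⊖ U (h ⊛ ψ)))) ⟩
  φ ^ˢ 5 ⊕ const (+ 9) ⊛ (ψ ^ˢ 3 ⊛ (k ⊕ ⊖ U (h ⊛ ψ))) ∎)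
  where
  open ≈-Reasoning
  ψ = ε p̄-series
  h = proj₁ (ninth-power φ)
  k = proj₁ U-φ⁸
  U-const⊛ : ∀ c f → U (const c ⊛ f) ≈ const c ⊛ U f
  U-const⊛ c f = pointwise λ n → trans (const-⊛ c f (n * 3)) (sym (const-⊛ c (U f) n))
  φ³-U : φ ^ˢ 3 ⊛ U ψ ⊕ const (+ 9) ⊛ U (h ⊛ ψ) ≈ φ ^ˢ 8 ⊕ const (+ 9) ⊛ k
  φ³-U = begin
    φ ^ˢ 3 ⊛ U ψ ⊕ const (+ 9) ⊛ U (h ⊛ ψ)
      ≈⟨ ⊕-cong (solve 2 (λ f u → f :^ 3 :* u := f :* (f :* (f :* u))) ≈-refl φ (U ψ)) (≈-sym (U-const⊛ (+ 9) (h ⊛ ψ))) ⟩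
    φ ⊛ (φ ⊛ (φ ⊛ U ψ)) ⊕ U (const (+ 9) ⊛ (h ⊛ ψ))
      ≈⟨ ⊕-cong (≈-sym (≈-trans (U-V⊛ φ (V φ ⊛ (V φ ⊛ ψ))) (⊛-cong (≈-refl {φ})
          (≈-trans (U-V⊛ φ (V φ ⊛ ψ)) (⊛-cong (≈-refl {φ}) (U-V⊛ φ ψ)))))) (≈-refl {U (const (+ 9) ⊛ (h ⊛ ψ))}) ⟩
    U (V φ ⊛ (V φ ⊛ (V φ ⊛ ψ)) ⊕ const (+ 9) ⊛ (h ⊛ ψ))
      ≈⟨ U-cong (solve 3 (λ v h q →
           v :* (v :* (v :* q)) :+ con (+ 9) :* (h :* q) := (v :^ 3 :+ con (+ 9) :* h) :* q) ≈-refl (V φ) h ψ) ⟩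
    U ((V φ ^ˢ 3 ⊕ const (+ 9) ⊛ h) ⊛ ψ)
      ≈⟨ U-cong (⊛-cong (≈-sym (proj₂ (ninth-power φ))) (≈-refl {ψ})) ⟩
    U (φ ^ˢ 9 ⊛ ψ)
      ≈⟨ U-cong (solve 2 (λ f q → f :^ 9 :* q := (q :* f) :* f :^ 8) ≈-refl φ ψ) ⟩
    U ((ψ ⊛ φ) ⊛ φ ^ˢ 8)
      ≈⟨ U-cong (≈-trans (⊛-cong εp̄-⊛-φ (≈-refl {φ ^ˢ 8})) (⊛-identityˡ (φ ^ˢ 8))) ⟩
    U (φ ^ˢ 8)
      ≈⟨ proj₂ U-φ⁸ ⟩
    φ ^ˢ 8 ⊕ const (+ 9) ⊛ k ∎

theorem5 : (n : ℕ) → n ≥ 1 → + p̄ (3 * n) ≡ (-1ℤ ^ℤ n) *ℤ + r 5 n [mod + 9 ]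
theorem5 n _ = Signed.∣⇒∣ᵤ (Signed.divides (s *ℤ h n) (begin
  + p̄ (3 * n) -ℤ s *ℤ + r 5 n
    ≡⟨ cong (λ m → + p̄ m -ℤ s *ℤ + r 5 n) (ℕ.*-comm 3 n) ⟩
  + p̄ (n * 3) -ℤ s *ℤ + r 5 n
    ≡⟨ cong (_-ℤ s *ℤ + r 5 n) (sym (ε-involutive p̄-series (n * 3))) ⟩
  -1ℤ ^ℤ (n * 3) *ℤ U (ε p̄-series) n -ℤ s *ℤ + r 5 n
    -- The coefficient of ψ at 3n carries the sign (-1)^(3n), which equals (-1)ⁿ because 3 is odd.
    ≡⟨ cong₂ (λ x y → x *ℤ y -ℤ s *ℤ + r 5 n) (sign n) (trans (at (proj₂ U-inverse) n)
         (cong₂ _+ℤ_ (sym (at (r-series-φ 5) n)) (const-⊛ (+ 9) h n))) ⟩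
  s *ℤ (+ r 5 n +ℤ + 9 *ℤ h n) -ℤ s *ℤ + r 5 n
    ≡⟨ collect s (+ r 5 n) (h n) ⟩
  s *ℤ h n *ℤ + 9 ∎))
  where
  open ≡-Reasoning
  s = -1ℤ ^ℤ n
  h = proj₁ U-inverse
  sign : ∀ n → -1ℤ ^ℤ (n * 3) ≡ -1ℤ ^ℤ n
  sign zero    = refl
  sign (suc n) = trans (cube (-1ℤ ^ℤ (n * 3))) (cong (-1ℤ *ℤ_) (sign n))
    where
    cube : ∀ x → -1ℤ *ℤ (-1ℤ *ℤ (-1ℤ *ℤ x)) ≡ -1ℤ *ℤ x
    cube = solve-∀
  collect : ∀ s r h → s *ℤ (r +ℤ + 9 *ℤ h) -ℤ s *ℤ r ≡ s *ℤ h *ℤ + 9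
  collect = solve-∀
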